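{- Let $\mathbb{F}$ be a field and let $P$ be a syntactic multilinear ABP of size $S$ computing a polynomial $f\in\mathbb{F}[x_1,\ldots,x_n]$. Then there exists a syntactic multilinear $\Sigma\Pi^{[\sqrt n]}(\Sigma\Pi)^{[\sqrt n]}$ formula of size $2^{O(\sqrt n\,\log n\,\log S)}$ computing $f$.
   Context: Let $X=\{x_1,\ldots,x_n\}$. An algebraic branching program (ABP) over $\mathbb{F}$ is a directed acyclic graph whose vertices are partitioned into layers $L_0,\ldots,L_\ell$, with edges going only from $L_i$ to $L_{i+1}$; $L_0=\{s\}$ (source, the one vertex of in-degree 0) and $L_\ell=\{t\}$ (sink, the one vertex of out-degree 0). Each edge is labeled by an element of $X\cup\mathbb{F}$. The size is the number of nodes. The polynomial computed is the sum over all $s$-to-$t$ paths of the product of the edge labels. The ABP is syntactic multilinear if every variable occurs at most once on every $s$-to-$t$ path. A $\Sigma\Pi^{[\sqrt n]}(\Sigma\Pi)^{[\sqrt n]}$ formula is a depth-four arithmetic formula (unbounded fan-in, alternating layers of $+$ and $\times$ gates, with a $+$ gate on top) computing an expression $\sum_{i=1}^{T}\prod_{j=1}^{d_i}Q_{ij}$, where each $d_i=O(\sqrt n)$ and each $Q_{ij}$ is a multilinear polynomial in $O(\sqrt n)$ variables, given as a sum of monomials. It is syntactic multilinear if the children of every product gate depend on pairwise disjoint sets of variables. The size of a formula is its number of gates. The constants hidden in $O(\cdot)$ are absolute. -}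

module Defs where

open import Algebra.Apartness.Bundles using (HeytingField)
open import Data.Bool.Base using (if_then_else_)
open import Data.Empty using (⊥-elim)
open import Data.Fin.Base using (Fin; zero; fromℕ; toℕ)
open import Data.Fin.Properties using (_≟_; toℕ-fromℕ)
open import Data.Fin.Subset using (Subset; ⁅_⁆; ⋃; _∩_; Empty; ∣_∣)
import Data.Fin.Subset as Subset
open import Data.List.Base using (List; []; _∷_; [_]; _++_; map; foldr; concatMap; cartesianProductWith; allFin; length; sum)
open import Data.List.Membership.Propositional using (_∈_; lose)
open import Data.List.Membership.Propositional.Properties using (∈-concatMap⁺; ∈-cartesianProductWith⁺; ∈-cartesianProductWith⁻; ∈-allFin)
import Data.List.Relation.Binary.Disjoint.Propositional as List
open import Data.List.Relation.Unary.All using (All; []; _∷_; universal)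
import Data.List.Relation.Unary.All.Properties as All
open import Data.List.Relation.Unary.AllPairs using (AllPairs; []; _∷_)
import Data.List.Relation.Unary.AllPairs as AllPairs
import Data.List.Relation.Unary.AllPairs.Properties as AllPairs
open import Data.List.Relation.Unary.Any using (here)
open import Data.List.Relation.Unary.Unique.Propositional using (Unique)
import Data.List.Relation.Unary.Unique.Propositional.Properties as Unique
open import Data.Maybe.Base using (Maybe; just; nothing)
open import Data.Nat.Base using (ℕ; zero; suc; _+_; _*_; _⊔_; _≤_; _<_; z≤n; s≤s)
open import Data.Nat.Logarithm using (⌊log₂_⌋)
open import Data.Nat.Properties using (_≤?_; ≤-trans; m≤n⇒m≤1+n; ≰⇒>; *-mono-<; n<1+n; +-suc; +-identityʳ)
import Data.Nat.Properties as ℕ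
open import Data.Product using (∃; _×_; _,_)
open import Data.Vec.Base using (Vec; zipWith; replicate; lookup; _[_]≔_)
open import Data.Vec.Properties using (≡-dec)
open import Function.Bundles using (_⇔_; Equivalence)
import Level
open import Relation.Binary.PropositionalEquality using (_≡_; _≢_; refl; sym; trans; cong; subst)
open import Relation.Nullary using (does; yes; no)

⌊√_⌋ : ℕ → ℕ
⌊√ zero ⌋ = 0
⌊√ suc n ⌋ with suc ⌊√ n ⌋ * suc ⌊√ n ⌋ ≤? suc n
... | yes _ = suc ⌊√ n ⌋
... | no  _ = ⌊√ n ⌋

⌊√⌋-spec : ∀ n → (⌊√ n ⌋ * ⌊√ n ⌋ ≤ n) × (n < suc ⌊√ n ⌋ * suc ⌊√ n ⌋)
⌊√⌋-spec zero = z≤n , s≤s z≤n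
⌊√⌋-spec (suc n) with suc ⌊√ n ⌋ * suc ⌊√ n ⌋ ≤? suc n | ⌊√⌋-spec n
... | yes r²≤1+n | _ , n<r² =
  r²≤1+n , ≤-trans (s≤s n<r²) (*-mono-< (n<1+n (suc ⌊√ n ⌋)) (n<1+n (suc ⌊√ n ⌋)))
... | no  r²≰1+n | r²≤n , _ = m≤n⇒m≤1+n r²≤n , ≰⇒> r²≰1+n

-- The scales occurring inside O(·).  Rounding down only makes a bound
-- k · √⁺ n sharper than k · √n.  The floor at 1 matters only for n = 0
-- (square root) and n ≤ 1 (logarithm), where √n or log n vanishes and a
-- bound O(0) would be false: for n = 0 the constant polynomial a needs a
-- non-empty product, and for n = 1 or S = 1 the size 2^0 is too small.
√⁺ : ℕ → ℕ
√⁺ n = 1 ⊔ ⌊√ n ⌋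

log⁺ : ℕ → ℕ
log⁺ n = 1 ⊔ ⌊log₂ n ⌋

module OverField {c ℓ₁ ℓ₂} (F : HeytingField c ℓ₁ ℓ₂) where

  private module F = HeytingField F

  -- F[x₁,…,xₙ]: formal sums of terms a·x₁^e₁⋯xₙ^eₙ.  The same exponent vector may
  -- occur repeatedly, so polynomials are compared by _≈ₚ_, not by _≡_.
  Poly : ℕ → Set c
  Poly n = List (F.Carrier × Vec ℕ n)

  coeff : ∀ {n} → Poly n → Vec ℕ n → F.Carrier
  coeff []            m = F.0#
  coeff ((a , e) ∷ p) m =
    if does (≡-dec ℕ._≟_ e m) then a F.+ coeff p m else coeff p m

  infix 4 _≈ₚ_
  _≈ₚ_ : ∀ {n} → Poly n → Poly n → Set ℓ₁
  p ≈ₚ q = ∀ m → coeff p m F.≈ coeff q m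

  constₚ : ∀ {n} → F.Carrier → Poly n
  constₚ {n} a = [ a , replicate n 0 ]

  varₚ : ∀ {n} → Fin n → Poly n
  varₚ {n} i = [ F.1# , replicate n 0 [ i ]≔ 1 ]

  infixl 6 _+ₚ_
  _+ₚ_ : ∀ {n} → Poly n → Poly n → Poly n
  _+ₚ_ = _++_

  infixl 7 _*ₚ_
  _*ₚ_ : ∀ {n} → Poly n → Poly n → Poly n
  _*ₚ_ = cartesianProductWith λ { (a , d) (b , e) → a F.* b , zipWith _+_ d e }

  Σₚ : ∀ {n} → List (Poly n) → Poly n
  Σₚ = foldr _+ₚ_ []

  Πₚ : ∀ {n} → List (Poly n) → Poly n
  Πₚ = foldr _*ₚ_ (constₚ F.1#)

  Multilinear : ∀ {n} → Poly n → Set ℓ₁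
  Multilinear p = ∀ m i → 2 ≤ lookup m i → coeff p m F.≈ F.0#

  -- Elements of X ∪ F.
  data Label (n : ℕ) : Set c where
    var   : Fin n → Label n
    const : F.Carrier → Label n

  labelₚ : ∀ {n} → Label n → Poly n
  labelₚ (var i)   = varₚ i
  labelₚ (const a) = constₚ a

  -- ABPs on n variables with S nodes; `edge u v` is the label of the edge
  -- from u to v, if there is one.
  record ABP (n S : ℕ) : Set c where
    field
      depth      : ℕ
      layer      : Fin S → Fin (suc depth)
      edge       : Fin S → Fin S → Maybe (Label n)
      edge-layer : ∀ {u v l} → edge u v ≡ just l →
                   toℕ (layer v) ≡ suc (toℕ (layer u))
      s t        : Fin S
      first      : ∀ v → layer v ≡ zero ⇔ v ≡ s
      last       : ∀ v → layer v ≡ fromℕ depth ⇔ v ≡ t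
      source     : ∀ v → (∀ u → edge u v ≡ nothing) ⇔ v ≡ s
      sink       : ∀ u → (∀ v → edge u v ≡ nothing) ⇔ u ≡ t

    Edge : Fin S → Fin S → Set c
    Edge u v = ∃ λ l → edge u v ≡ just l

    infixr 5 _∷_
    data Path : Fin S → Fin S → Set c where
      []  : ∀ {u} → Path u u
      _∷_ : ∀ {u v w} → Edge u v → Path v w → Path u w

    weight : ∀ {u v} → Path u v → Poly n
    weight []            = constₚ F.1#
    weight ((l , _) ∷ p) = labelₚ l *ₚ weight p

    -- With repetitions.
    variables : ∀ {u v} → Path u v → List (Fin n)
    variables []                  = []
    variables ((var i   , _) ∷ p) = i ∷ variables p
    variables ((const _ , _) ∷ p) = variables p

    edges : ∀ u v → List (Edge u v)
    edges u v with edge u v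
    ... | just l  = [ l , refl ]
    ... | nothing = []

    pathsOfLength : ℕ → ∀ u v → List (Path u v)
    pathsOfLength zero u v with u ≟ v
    ... | yes refl = [ [] ]
    ... | no  _    = []
    pathsOfLength (suc k) u v =
      concatMap (λ w → cartesianProductWith _∷_ (edges u w) (pathsOfLength k w v))
                (allFin S)

    -- All s-to-t paths, each listed once (∈-stPaths and stPaths-unique
    -- below): by the layering they all have length `depth`.
    stPaths : List (Path s t)
    stPaths = pathsOfLength depth s t

    polynomial : Poly n
    polynomial = Σₚ (map weight stPaths)

    SyntacticMultilinear : Set c
    SyntacticMultilinear = (p : Path s t) → Unique (variables p)

    pathLength : ∀ {u v} → Path u v → ℕ
    pathLength []      = 0
    pathLength (_ ∷ p) = suc (pathLength p)

    layer-path : ∀ {u v} (p : Path u v) →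
                 toℕ (layer v) ≡ toℕ (layer u) + pathLength p
    layer-path []      = sym (+-identityʳ _)
    layer-path ((_ , eq) ∷ p) =
      trans (layer-path p)
            (trans (cong (_+ pathLength p) (edge-layer eq)) (sym (+-suc _ _)))

    pathLength-st : (p : Path s t) → pathLength p ≡ depth
    pathLength-st p = trans (sym s-side) (trans (sym (layer-path p)) t-side)
      where
      s-side : toℕ (layer s) + pathLength p ≡ pathLength p
      s-side = cong (λ i → toℕ i + pathLength p) (Equivalence.from (first s) refl)
      t-side : toℕ (layer t) ≡ depth
      t-side = trans (cong toℕ (Equivalence.from (last t) refl)) (toℕ-fromℕ depth)

    ∈-edges : ∀ {u v} (e : Edge u v) → e ∈ edges u v
    ∈-edges {u} {v} (l , eq) with edge u v
    ∈-edges (l , refl) | just .l = here refl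

    ∈-pathsOfLength : ∀ {u v} (p : Path u v) → p ∈ pathsOfLength (pathLength p) u v
    ∈-pathsOfLength {u} [] with u ≟ u
    ... | yes refl = here refl
    ... | no  u≢u  = ⊥-elim (u≢u refl)
    ∈-pathsOfLength (_∷_ {v = v} e p) =
      ∈-concatMap⁺ _
        (lose (∈-allFin v) (∈-cartesianProductWith⁺ _∷_ (∈-edges e) (∈-pathsOfLength p)))

    ∈-stPaths : (p : Path s t) → p ∈ stPaths
    ∈-stPaths p =
      subst (λ k → p ∈ pathsOfLength k s t) (pathLength-st p) (∈-pathsOfLength p)

    edges-unique : ∀ u v → Unique (edges u v)
    edges-unique u v with edge u v
    ... | just _  = [] ∷ []
    ... | nothing = []

    pathsOfLength-unique : ∀ k u v → Unique (pathsOfLength k u v)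
    pathsOfLength-unique zero u v with u ≟ v
    ... | yes refl = [] ∷ []
    ... | no  _    = []
    pathsOfLength-unique (suc k) u v =
      Unique.concat⁺
        (All.map⁺ (universal
          (λ w → Unique.cartesianProductWith⁺ _∷_ (λ { refl → refl , refl })
                   (edges-unique u w) (pathsOfLength-unique k w v))
          (allFin S)))
        (AllPairs.map⁺ (AllPairs.map disjoint (Unique.allFin⁺ S)))
      where
      via : Fin S → List (Path u v)
      via w = cartesianProductWith _∷_ (edges u w) (pathsOfLength k w v)

      disjoint : ∀ {w w′} → w ≢ w′ → List.Disjoint (via w) (via w′)
      disjoint {w} {w′} w≢w′ (p∈ , p∈′)
        with ∈-cartesianProductWith⁻ _∷_ (edges u w) _ p∈
           | ∈-cartesianProductWith⁻ _∷_ (edges u w′) _ p∈′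
      ... | _ , _ , _ , _ , refl | _ , _ , _ , _ , refl = w≢w′ refl

    stPaths-unique : Unique stPaths
    stPaths-unique = pathsOfLength-unique depth s t

  -- A list holds the children of a gate; the prefix names the gate types
  -- from the root down, and the leaves are labels.
  Π-Formula ΣΠ-Formula ΠΣΠ-Formula ΣΠΣΠ-Formula : ℕ → Set c
  Π-Formula    n = List (Label n)
  ΣΠ-Formula   n = List (Π-Formula n)
  ΠΣΠ-Formula  n = List (ΣΠ-Formula n)
  ΣΠΣΠ-Formula n = List (ΠΣΠ-Formula n)

  module _ {n : ℕ} where

    ⟦_⟧Π : Π-Formula n → Poly n
    ⟦ M ⟧Π = Πₚ (map labelₚ M)

    ⟦_⟧ΣΠ : ΣΠ-Formula n → Poly n
    ⟦ Q ⟧ΣΠ = Σₚ (map ⟦_⟧Π Q)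

    ⟦_⟧ΠΣΠ : ΠΣΠ-Formula n → Poly n
    ⟦ R ⟧ΠΣΠ = Πₚ (map ⟦_⟧ΣΠ R)

    ⟦_⟧ : ΣΠΣΠ-Formula n → Poly n
    ⟦ Φ ⟧ = Σₚ (map ⟦_⟧ΠΣΠ Φ)

    -- Input gates (leaves) are counted too.
    sizeΠ : Π-Formula n → ℕ
    sizeΠ M = suc (length M)

    sizeΣΠ : ΣΠ-Formula n → ℕ
    sizeΣΠ Q = suc (sum (map sizeΠ Q))

    sizeΠΣΠ : ΠΣΠ-Formula n → ℕ
    sizeΠΣΠ R = suc (sum (map sizeΣΠ R))

    size : ΣΠΣΠ-Formula n → ℕ
    size Φ = suc (sum (map sizeΠΣΠ Φ))

    -- The variables a subformula depends on, read syntactically: those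
    -- labelling one of its leaves.
    varsLabel : Label n → Subset n
    varsLabel (var i)   = ⁅ i ⁆
    varsLabel (const _) = Subset.⊥

    varsΠ : Π-Formula n → Subset n
    varsΠ M = ⋃ (map varsLabel M)

    varsΣΠ : ΣΠ-Formula n → Subset n
    varsΣΠ Q = ⋃ (map varsΠ Q)

    PairwiseDisjoint : List (Subset n) → Set
    PairwiseDisjoint = AllPairs λ A B → Empty (A ∩ B)

    -- One condition for each of the two layers of product gates.
    FormulaSyntacticMultilinear : ΣΠΣΠ-Formula n → Set c
    FormulaSyntacticMultilinear =
      All λ R → PairwiseDisjoint (map varsΣΠ R)
              × All (All λ M → PairwiseDisjoint (map varsLabel M)) R

    -- The class ΣΠ^[√n](ΣΠ)^[√n], with k₁ and k₂ the constants hidden in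
    -- the two bounds O(√n).
    IsΣΠ[√n]⟨ΣΠ⟩[√n] : (k₁ k₂ : ℕ) → ΣΠΣΠ-Formula n → Set (c Level.⊔ ℓ₁)
    IsΣΠ[√n]⟨ΣΠ⟩[√n] k₁ k₂ =
      All λ R → length R ≤ k₁ * √⁺ n
              × All (λ Q → Multilinear ⟦ Q ⟧ΣΠ × ∣ varsΣΠ Q ∣ ≤ k₂ * √⁺ n) R

{-# OPTIONS --safe #-}
module Submission where

open import Defs
open import Algebra.Apartness.Bundles using (HeytingField)
open import Algebra.Bundles using (CommutativeSemiring)
import Algebra.Properties.CommutativeSemigroup as CommutativeSemigroupProperties
open import Algebra.Structures.Biased using (isCommutativeSemiringˡ)
open import Data.Bool.Base using (Bool; true; false; if_then_else_; not)
open import Data.Fin.Base using (Fin; zero; suc; toℕ)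
open import Data.Fin.Properties using (_≟_; suc-injective; toℕ-fromℕ; toℕ-injective; toℕ≤pred[n])
import Data.Fin.Properties as Fin
open import Data.Fin.Subset using (Subset; inside; outside; ⁅_⁆; ⋃; _∩_; _⊆_; Empty; ∣_∣)
import Data.Fin.Subset as Subset
open import Data.Fin.Subset.Properties using (p⊆q⇒∣p∣≤∣q∣; drop-∷-⊆; x∈p∪q⁻; x∈p∩q⁻; x∈⁅x⁆; x∈⁅y⁆⇒x≡y; ∉⊥; ⊥⊆; x∈p∪q⁺; ∣⊥∣≡0; ∣⁅x⁆∣≡1; ∣p∣≤n)
open import Data.List.Base using (List; []; _∷_; [_]; _++_; map; concatMap; allFin; length; cartesianProductWith)
open import Data.List.Membership.Propositional using (_∈_; find; lose)
open import Data.List.Membership.Propositional.Properties using (∈-allFin; ∈-map⁺; ∈-map⁻; ∈-++⁺ˡ; ∈-++⁺ʳ; ∈-++⁻; ∈-concatMap⁺; ∈-concatMap⁻)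
open import Data.List.Properties using (map-++; map-∘; ++-assoc; ++-identityʳ; cartesianProductWith-distribʳ-++; length-map; length-++; length-tabulate)
import Data.List.Relation.Binary.Disjoint.Propositional as List
open import Data.List.Relation.Binary.Pointwise using (Pointwise; []; _∷_)
import Data.List.Relation.Binary.Pointwise as Pointwise
open import Data.List.Relation.Unary.All using (All; []; _∷_)
import Data.List.Relation.Unary.All as All
import Data.List.Relation.Unary.All.Properties as All
open import Data.List.Relation.Unary.AllPairs using ([]; _∷_)
import Data.List.Relation.Unary.AllPairs as AllPairs
import Data.List.Relation.Unary.AllPairs.Properties as AllPairs
open import Data.List.Relation.Unary.Any using (here; there; any?)
open import Data.List.Relation.Unary.Unique.Propositional using (Unique)
import Data.List.Relation.Unary.Unique.Propositional.Properties as Unique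
open import Data.Maybe.Base using (Maybe; just; nothing; maybe′)
open import Data.Nat.Base using (ℕ; zero; suc; _+_; _*_; _∸_; _^_; _≤_; z≤n; s≤s; _<_; s≤s⁻¹)
open import Data.Nat.ListAction using (sum)
open import Data.Nat.Logarithm using (⌊log₂_⌋; ⌊log₂⌋-mono-≤; ⌊log₂[2^n]⌋≡n)
import Data.Nat.Properties as ℕ
open import Data.Nat.Tactic.RingSolver using (solve-∀)
open import Data.Product using (∃; _×_; _,_; proj₁; proj₂)
open import Data.Sum.Base using (inj₁; inj₂; [_,_]′)
open import Data.Vec.Base using (Vec; []; _∷_; zipWith; replicate; lookup; _[_]≔_; here; there)
import Data.Vec.Base as Vec
open import Data.Vec.Properties using (≡-dec; zipWith-assoc; zipWith-comm; zipWith-identityˡ; ∷-injective)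
open import Function.Base using (_∘_; id)
open import Function.Bundles using (Equivalence)
open import Level using (Level)
open import Relation.Binary.PropositionalEquality using (_≡_; _≢_; refl; sym; trans; cong; cong₂; subst)
import Relation.Binary.Reasoning.Setoid as SetoidReasoning
open import Relation.Binary.Structures using (IsEquivalence)
open import Relation.Nullary using (¬_; Dec; yes; no; does; contradiction)
open import Relation.Nullary.Decidable using (dec-true; dec-false; _×-dec_)

-- Let X(u,v) be the set of variables on the paths from u to v.  Syntactic
-- multilinearity makes X(u,v) and X(v,w) disjoint, since any two paths u → v → w
-- extend to an s-to-t path.  Put r = √n and cut every path greedily: from the
-- current node u, follow it while it stays in W = {w : |X(u,w)| ≤ r}, a set it leaves
-- along some edge w → v; go on from v.  If t ∉ W, this gives
--   f(u,t) = Σ_{w ∈ W, v ∉ W} g(u,w) · label(w,v) · f(v,t)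
-- with g(u,w) the sum over the paths inside W, a polynomial in at most r variables.
-- Each cut uses up more than r of the n variables of X(s,t), so there are at most r
-- cuts, hence at most 2r+1 factors per product and S^(2r) products.

-- Cutting at fixed layers would not work: constant edges can make paths arbitrarily long and the
-- variables may crowd into a few layers, so a piece could still depend on too many of them. Hence
-- the cut follows the number of variables. The edge w → v has to be a factor of its own: X(u,w) has
-- at most r elements, but X(u,v) may be far larger, since other paths into v can bring in any
-- number of variables. That excess also pays for the cut: with n < (r+1)^2 and at least r+1
-- variables used per cut, at most r are left after r cuts. The number of paths behind g(u,w) is not
-- bounded in terms of r. Each factor is therefore rewritten with one coefficient for every subset
-- of its variables, at most 2^r monomials. The identity for f(u,t) is proved without manipulating
-- sets of paths: both sides obey the same linear recursion along the layers.

module Polynomials {c ℓ₁ ℓ₂} (F : HeytingField c ℓ₁ ℓ₂) (n : ℕ) where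

  open OverField F
  private
    module F = HeytingField F
    module F-Reasoning = SetoidReasoning F.setoid

  -- The commutative semiring of polynomials up to equality of coefficients.

  Term : Set c
  Term = F.Carrier × Vec ℕ n

  infixl 7 _⊙_
  _⊙_ : Term → Term → Term
  (a , d) ⊙ (b , e) = a F.* b , zipWith _+_ d e

  coeff-∷-≡ : ∀ {a e m} (p : Poly n) → e ≡ m → coeff ((a , e) ∷ p) m ≡ a F.+ coeff p m
  coeff-∷-≡ {e = e} {m} p e≡m rewrite dec-true (≡-dec ℕ._≟_ e m) e≡m = refl

  coeff-∷-≢ : ∀ {a e m} (p : Poly n) → e ≢ m → coeff ((a , e) ∷ p) m ≡ coeff p m
  coeff-∷-≢ {e = e} {m} p e≢m rewrite dec-false (≡-dec ℕ._≟_ e m) e≢m = refl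

  -- The polynomials compared cannot be inferred from a proof of p ≈ₚ q, which
  -- unfolds to equations between coefficients; they can from one of p ≃ q.
  infix 4 _≃_
  record _≃_ (p q : Poly n) : Set ℓ₁ where
    constructor coefficientwise
    field
      coeff-cong : p ≈ₚ q

  open _≃_ public

  coeff-++ : ∀ p q (m : Vec ℕ n) → coeff (p ++ q) m F.≈ coeff p m F.+ coeff q m
  coeff-++ []            q m = F.sym (F.+-identityˡ _)
  coeff-++ ((a , e) ∷ p) q m with does (≡-dec ℕ._≟_ e m)
  ... | true  = F.trans (F.+-congˡ (coeff-++ p q m)) (F.sym (F.+-assoc _ _ _))
  ... | false = coeff-++ p q m

  coeff-absent : ∀ {p} {m : Vec ℕ n} → All (λ t → proj₂ t ≢ m) p → coeff p m F.≈ F.0#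
  coeff-absent []                       = F.refl
  coeff-absent {(_ , _) ∷ p} (e≢m ∷ ps) = F.trans (F.reflexive (coeff-∷-≢ p e≢m)) (coeff-absent ps)

  ∷-cong : ∀ {a b d e} {p q : Poly n} → a F.≈ b → d ≡ e → p ≃ q → (a , d) ∷ p ≃ (b , e) ∷ q
  ∷-cong {e = e} a≈b refl p≈q .coeff-cong m with does (≡-dec ℕ._≟_ e m)
  ... | true  = F.+-cong a≈b (coeff-cong p≈q m)
  ... | false = coeff-cong p≈q m

  _≋_ : Poly n → Poly n → Set _
  _≋_ = Pointwise λ s t → proj₁ s F.≈ proj₁ t × proj₂ s ≡ proj₂ t

  ≋⇒≃ : ∀ {p q} → p ≋ q → p ≃ q
  ≋⇒≃ []                  = coefficientwise λ _ → F.refl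
  ≋⇒≃ ((a≈b , d≡e) ∷ p≋q) = ∷-cong a≈b d≡e (≋⇒≃ p≋q)

  ≃-refl : ∀ {p : Poly n} → p ≃ p
  ≃-refl .coeff-cong m = F.refl

  ≃-reflexive : ∀ {p q : Poly n} → p ≡ q → p ≃ q
  ≃-reflexive refl = ≃-refl

  ≃-sym : ∀ {p q : Poly n} → p ≃ q → q ≃ p
  ≃-sym p≈q .coeff-cong m = F.sym (coeff-cong p≈q m)

  ≃-trans : ∀ {p q r : Poly n} → p ≃ q → q ≃ r → p ≃ r
  ≃-trans p≈q q≈r .coeff-cong m = F.trans (coeff-cong p≈q m) (coeff-cong q≈r m)

  +ₚ-cong : ∀ {p p′ q q′ : Poly n} → p ≃ p′ → q ≃ q′ → p +ₚ q ≃ p′ +ₚ q′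
  +ₚ-cong {p} {p′} {q} {q′} p≈p′ q≈q′ .coeff-cong m =
    F.trans (coeff-++ p q m)
      (F.trans (F.+-cong (coeff-cong p≈p′ m) (coeff-cong q≈q′ m)) (F.sym (coeff-++ p′ q′ m)))

  +ₚ-assoc : ∀ p q r → (p +ₚ q) +ₚ r ≃ p +ₚ (q +ₚ r)
  +ₚ-assoc p q r = ≃-reflexive (++-assoc p q r)

  +ₚ-comm : ∀ p q → p +ₚ q ≃ q +ₚ p
  +ₚ-comm p q .coeff-cong m =
    F.trans (coeff-++ p q m) (F.trans (F.+-comm _ _) (F.sym (coeff-++ q p m)))

  zipWith-+-cancelˡ : ∀ {k} (d {e m} : Vec ℕ k) → zipWith _+_ d e ≡ zipWith _+_ d m → e ≡ m
  zipWith-+-cancelˡ []      {[]}    {[]}    _  = refl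
  zipWith-+-cancelˡ (x ∷ d) {y ∷ e} {z ∷ m} eq =
    cong₂ _∷_ (ℕ.+-cancelˡ-≡ x y z (proj₁ (∷-injective eq)))
              (zipWith-+-cancelˡ d (proj₂ (∷-injective eq)))

  zipWith-∸-+ : ∀ {k} (d e : Vec ℕ k) → zipWith _∸_ (zipWith _+_ d e) d ≡ e
  zipWith-∸-+ []      []      = refl
  zipWith-∸-+ (x ∷ d) (y ∷ e) = cong₂ _∷_ (ℕ.m+n∸m≡n x y) (zipWith-∸-+ d e)

  -- Adding `d` is injective on exponent vectors, so the terms of the product at d + m are exactly
  -- the images of the terms of `q` at `m`.
  coeff-⊙ : ∀ a d q m → coeff (map ((a , d) ⊙_) q) (zipWith _+_ d m) F.≈ a F.* coeff q m
  coeff-⊙ a d []            m = F.sym (F.zeroʳ a)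
  coeff-⊙ a d ((b , e) ∷ q) m with ≡-dec ℕ._≟_ e m
  ... | yes e≡m = begin
    coeff (map ((a , d) ⊙_) ((b , e) ∷ q)) (zipWith _+_ d m)
      ≡⟨ coeff-∷-≡ (map ((a , d) ⊙_) q) (cong (zipWith _+_ d) e≡m) ⟩
    a F.* b F.+ coeff (map ((a , d) ⊙_) q) (zipWith _+_ d m)
      ≈⟨ F.+-congˡ (coeff-⊙ a d q m) ⟩
    a F.* b F.+ a F.* coeff q m
      ≈⟨ F.distribˡ a b (coeff q m) ⟨
    a F.* (b F.+ coeff q m) ∎
    where open F-Reasoning
  ... | no e≢m =
    F.trans (F.reflexive (coeff-∷-≢ (map ((a , d) ⊙_) q) (λ eq → e≢m (zipWith-+-cancelˡ d eq))))
            (coeff-⊙ a d q m)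

  coeff-⊙-absent : ∀ a d q m → (∀ e → zipWith _+_ d e ≢ m) →
                   coeff (map ((a , d) ⊙_) q) m F.≈ F.0#
  coeff-⊙-absent a d []            m ∌ = F.refl
  coeff-⊙-absent a d ((b , e) ∷ q) m ∌ =
    F.trans (F.reflexive (coeff-∷-≢ (map ((a , d) ⊙_) q) (∌ e))) (coeff-⊙-absent a d q m ∌)

  -- Every coefficient of the product is either a multiple of a coefficient of the argument or zero,
  -- hence depends on coefficients only and not on the list of terms. All congruences of `_*ₚ_`
  -- reduce to this case.
  ⊙-cong : ∀ t {p q} → p ≃ q → map (t ⊙_) p ≃ map (t ⊙_) q
  -- Truncated subtraction decides divisibility: `m` has the form d + e exactly when adding `d` to m
  -- ∸ d gives `m` back.
  ⊙-cong (a , d) {p} {q} p≈q .coeff-cong m with ≡-dec ℕ._≟_ (zipWith _+_ d (zipWith _∸_ m d)) m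
  ... | yes eq = subst (λ m → coeff (map ((a , d) ⊙_) p) m F.≈ coeff (map ((a , d) ⊙_) q) m) eq
    (F.trans (coeff-⊙ a d p _) (F.trans (F.*-congˡ (coeff-cong p≈q _)) (F.sym (coeff-⊙ a d q _))))
  ... | no ≢m = F.trans (coeff-⊙-absent a d p m ∌) (F.sym (coeff-⊙-absent a d q m ∌))
    where
    ∌ : ∀ e → zipWith _+_ d e ≢ m
    ∌ e refl = ≢m (cong (zipWith _+_ d) (zipWith-∸-+ d e))

  *ₚ-congˡ : ∀ p {q q′} → q ≃ q′ → p *ₚ q ≃ p *ₚ q′
  *ₚ-congˡ []      q≈q′ = ≃-refl
  *ₚ-congˡ (t ∷ p) {q} {q′} q≈q′ =
    +ₚ-cong (⊙-cong t q≈q′) (*ₚ-congˡ p q≈q′)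

  ⊙-comm : ∀ s t → proj₁ (s ⊙ t) F.≈ proj₁ (t ⊙ s) × proj₂ (s ⊙ t) ≡ proj₂ (t ⊙ s)
  ⊙-comm (a , d) (b , e) = F.*-comm a b , zipWith-comm ℕ.+-comm d e

  *ₚ-∷ʳ : ∀ q t p → q *ₚ (t ∷ p) ≃ map (t ⊙_) q +ₚ q *ₚ p
  *ₚ-∷ʳ []      t p = ≃-refl
  *ₚ-∷ʳ (s ∷ q) t p = ∷-cong (proj₁ (⊙-comm s t)) (proj₂ (⊙-comm s t)) tails
    where
    tails : map (s ⊙_) p +ₚ q *ₚ (t ∷ p) ≃ map (t ⊙_) q +ₚ (map (s ⊙_) p +ₚ q *ₚ p)
    tails = ≃-trans (+ₚ-cong ≃-refl (*ₚ-∷ʳ q t p))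
           (≃-trans (≃-sym (+ₚ-assoc (map (s ⊙_) p) (map (t ⊙_) q) (q *ₚ p)))
           (≃-trans (+ₚ-cong (+ₚ-comm (map (s ⊙_) p) (map (t ⊙_) q)) ≃-refl)
                     (+ₚ-assoc (map (t ⊙_) q) (map (s ⊙_) p) (q *ₚ p))))

  *ₚ-zeroʳ : ∀ p → p *ₚ [] ≃ []
  *ₚ-zeroʳ []      = ≃-refl
  *ₚ-zeroʳ (_ ∷ p) = *ₚ-zeroʳ p

  *ₚ-comm : ∀ p q → p *ₚ q ≃ q *ₚ p
  *ₚ-comm []      q = ≃-sym (*ₚ-zeroʳ q)
  *ₚ-comm (t ∷ p) q =
    ≃-trans (+ₚ-cong ≃-refl (*ₚ-comm p q)) (≃-sym (*ₚ-∷ʳ q t p))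

  -- The product recurses on its left factor, and `p ≃ p′` may relate lists of different shapes.
  -- Commutativity moves that change to the right factor, where `*ₚ-congˡ` applies.
  *ₚ-cong : ∀ {p p′ q q′} → p ≃ p′ → q ≃ q′ → p *ₚ q ≃ p′ *ₚ q′
  *ₚ-cong {p} {p′} {q} {q′} p≈p′ q≈q′ =
    ≃-trans (*ₚ-congˡ p q≈q′)
   (≃-trans (*ₚ-comm p q′) (≃-trans (*ₚ-congˡ q′ p≈p′) (*ₚ-comm q′ p′)))

  *ₚ-distribʳ-+ₚ : ∀ r p q → (p +ₚ q) *ₚ r ≃ p *ₚ r +ₚ q *ₚ r
  *ₚ-distribʳ-+ₚ r p q = ≃-reflexive (cartesianProductWith-distribʳ-++ _⊙_ p q r)

  ⊙-assoc-map : ∀ s t p → map (s ⊙ t ⊙_) p ≋ map (s ⊙_) (map (t ⊙_) p)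
  ⊙-assoc-map s t []      = []
  ⊙-assoc-map s@(a , d) t@(b , e) ((x , m) ∷ p) =
    (F.*-assoc a b x , zipWith-assoc ℕ.+-assoc d e m) ∷ ⊙-assoc-map s t p

  ⊙-*ₚ : ∀ t p q → map (t ⊙_) p *ₚ q ≃ map (t ⊙_) (p *ₚ q)
  ⊙-*ₚ t []      q = ≃-refl
  ⊙-*ₚ t (s ∷ p) q =
    ≃-trans (+ₚ-cong (≋⇒≃ (⊙-assoc-map t s q)) (⊙-*ₚ t p q))
             (≃-reflexive (sym (map-++ (t ⊙_) (map (s ⊙_) q) (p *ₚ q))))

  *ₚ-assoc : ∀ p q r → (p *ₚ q) *ₚ r ≃ p *ₚ (q *ₚ r)
  *ₚ-assoc []      q r = ≃-refl
  *ₚ-assoc (t ∷ p) q r =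
    ≃-trans (*ₚ-distribʳ-+ₚ r (map (t ⊙_) q) (p *ₚ q))
             (+ₚ-cong (⊙-*ₚ t q r) (*ₚ-assoc p q r))

  ⊙-identityˡ : ∀ p → map ((F.1# , replicate n 0) ⊙_) p ≋ p
  ⊙-identityˡ []            = []
  ⊙-identityˡ ((a , e) ∷ p) = (F.*-identityˡ a , zipWith-identityˡ ℕ.+-identityˡ e) ∷ ⊙-identityˡ p

  *ₚ-identityˡ : ∀ p → constₚ F.1# *ₚ p ≃ p
  *ₚ-identityˡ p = ≃-trans (≃-reflexive (++-identityʳ _)) (≋⇒≃ (⊙-identityˡ p))

  +ₚ-*ₚ-commutativeSemiring : CommutativeSemiring c ℓ₁
  +ₚ-*ₚ-commutativeSemiring = record
    { Carrier = Poly n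
    ; _≈_ = _≃_
    ; _+_ = _+ₚ_
    ; _*_ = _*ₚ_
    ; 0# = []
    ; 1# = constₚ F.1#
    ; isCommutativeSemiring = isCommutativeSemiringˡ record
      { +-isCommutativeMonoid = record
        { isMonoid = record
          { isSemigroup = record
            { isMagma = record { isEquivalence = isEquivalence ; ∙-cong = +ₚ-cong }
            ; assoc = +ₚ-assoc
            }
          ; identity = (λ _ → ≃-refl) , (λ p → ≃-reflexive (++-identityʳ p))
          }
        ; comm = +ₚ-comm
        }
      ; *-isCommutativeMonoid = record
        { isMonoid = record
          { isSemigroup = record
            { isMagma = record { isEquivalence = isEquivalence ; ∙-cong = *ₚ-cong }
            ; assoc = *ₚ-assoc
            }
          ; identity = *ₚ-identityˡ
                     , (λ p → ≃-trans (*ₚ-comm p (constₚ F.1#)) (*ₚ-identityˡ p))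
          }
        ; comm = *ₚ-comm
        }
      ; distribʳ = *ₚ-distribʳ-+ₚ
      ; zeroˡ = λ _ → ≃-refl
      }
    }
    where
    isEquivalence : IsEquivalence _≃_
    isEquivalence = record { refl = ≃-refl ; sym = ≃-sym ; trans = ≃-trans }

  private module P = CommutativeSemiring +ₚ-*ₚ-commutativeSemiring

  -- Finite sums of polynomials.

  module _ {a} {A : Set a} where

    ∑ : List A → (A → Poly n) → Poly n
    ∑ xs f = Σₚ (map f xs)

    ∑-cong : ∀ xs {f g} → (∀ x → f x ≃ g x) → ∑ xs f ≃ ∑ xs g
    ∑-cong []       f≈g = ≃-refl
    ∑-cong (x ∷ xs) {f} {g} f≈g = +ₚ-cong (f≈g x) (∑-cong xs f≈g)

    ∑-zero : ∀ xs {f} → All (λ x → f x ≃ []) xs → ∑ xs f ≃ []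
    ∑-zero []       []             = ≃-refl
    ∑-zero (x ∷ xs) {f} (fx≈0 ∷ p) = +ₚ-cong {f x} {[]} fx≈0 (∑-zero xs p)

    ∑-distrib-+ : ∀ xs f g → ∑ xs (λ x → f x +ₚ g x) ≃ ∑ xs f +ₚ ∑ xs g
    ∑-distrib-+ []       f g = ≃-refl
    ∑-distrib-+ (x ∷ xs) f g =
      ≃-trans (+ₚ-cong ≃-refl (∑-distrib-+ xs f g))
               (interchange (f x) (g x) (∑ xs f) (∑ xs g))
      where open CommutativeSemigroupProperties P.+-commutativeSemigroup using (interchange)

    *ₚ-distribˡ-∑ : ∀ p xs f → p *ₚ ∑ xs f ≃ ∑ xs (λ x → p *ₚ f x)
    *ₚ-distribˡ-∑ p []       f = *ₚ-zeroʳ p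
    *ₚ-distribˡ-∑ p (x ∷ xs) f =
      ≃-trans (P.distribˡ p (f x) (∑ xs f))
               (+ₚ-cong ≃-refl (*ₚ-distribˡ-∑ p xs f))

    *ₚ-distribʳ-∑ : ∀ p xs f → ∑ xs f *ₚ p ≃ ∑ xs (λ x → f x *ₚ p)
    *ₚ-distribʳ-∑ p []       f = ≃-refl
    *ₚ-distribʳ-∑ p (x ∷ xs) f =
      ≃-trans (*ₚ-distribʳ-+ₚ p (f x) (∑ xs f))
               (+ₚ-cong ≃-refl (*ₚ-distribʳ-∑ p xs f))

    ∑-single : ∀ {xs x f} → Unique xs → x ∈ xs → (∀ y → x ≢ y → f y ≃ []) → ∑ xs f ≃ f x
    ∑-single {x ∷ xs} {f = f} (x∉ ∷ _) (here refl) f≈0 =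
      ≃-trans (+ₚ-cong ≃-refl (∑-zero xs (All.map (f≈0 _) x∉))) (P.+-identityʳ (f x))
    ∑-single {y ∷ xs} {f = f} (y∉ ∷ uniq) (there x∈) f≈0 =
      +ₚ-cong (f≈0 y λ x≡y → All.lookup y∉ x∈ (sym x≡y)) (∑-single uniq x∈ f≈0)

  ∑-swap : ∀ {a b} {A : Set a} {B : Set b} xs ys (f : A → B → Poly n) →
           ∑ xs (λ x → ∑ ys (f x)) ≃ ∑ ys (λ y → ∑ xs (λ x → f x y))
  ∑-swap []       ys f = ≃-sym (∑-zero ys (All.universal (λ _ → ≃-refl) ys))
  ∑-swap (x ∷ xs) ys f =
    ≃-trans (+ₚ-cong ≃-refl (∑-swap xs ys f))
             (≃-sym (∑-distrib-+ ys (f x) (λ y → ∑ xs (λ x → f x y))))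

  ∑-++ : ∀ ps (qs : List (Poly n)) → Σₚ (ps ++ qs) ≡ Σₚ ps +ₚ Σₚ qs
  ∑-++ []       qs = refl
  ∑-++ (p ∷ ps) qs = trans (cong (p ++_) (∑-++ ps qs)) (sym (++-assoc p _ _))

  ∑-concatMap : ∀ {a b} {A : Set a} {B : Set b} (h : B → Poly n) (g : A → List B) xs →
                ∑ (concatMap g xs) h ≡ ∑ xs (λ x → ∑ (g x) h)
  ∑-concatMap h g []       = refl
  ∑-concatMap h g (x ∷ xs) =
    trans (cong Σₚ (map-++ h (g x) (concatMap g xs)))
   (trans (∑-++ (map h (g x)) (map h (concatMap g xs)))
          (cong (∑ (g x) h ++_) (∑-concatMap h g xs)))

  ∑-map : ∀ {a b} {A : Set a} {B : Set b} (h : B → Poly n) (g : A → B) xs →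
          ∑ (map g xs) h ≡ ∑ xs (λ x → h (g x))
  ∑-map h g xs = cong Σₚ (sym (map-∘ xs))

-- Subsets of the variables and their 0/1 exponent vectors.

⁅⁆⊆ : ∀ {k} {X : Subset k} {i} → i Subset.∈ X → ⁅ i ⁆ ⊆ X
⁅⁆⊆ {X = X} i∈X j∈ = subst (Subset._∈ X) (sym (x∈⁅y⁆⇒x≡y _ j∈)) i∈X

⋃⊆ : ∀ {k} {X : Subset k} {As} → All (_⊆ X) As → ⋃ As ⊆ X
⋃⊆ []                      i∈ = contradiction i∈ ∉⊥
⋃⊆ {As = A ∷ As} (A⊆ ∷ As⊆) i∈ = [ A⊆ , ⋃⊆ As⊆ ]′ (x∈p∪q⁻ A (⋃ As) i∈)

sum-≤ : ∀ {a} {A : Set a} (f : A → ℕ) {b xs} → All (λ x → f x ≤ b) xs → sum (map f xs) ≤ length xs * b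
sum-≤ f []         = z≤n
sum-≤ f (p ∷ all≤) = ℕ.+-mono-≤ p (sum-≤ f all≤)

indicator : ∀ {k} → Subset k → Vec ℕ k
indicator = Vec.map λ b → if b then 1 else 0

indicator-injective : ∀ {k} (A B : Subset k) → indicator A ≡ indicator B → A ≡ B
indicator-injective []            []            eq = refl
indicator-injective (outside ∷ A) (outside ∷ B) eq = cong (outside ∷_) (indicator-injective A B (proj₂ (∷-injective eq)))
indicator-injective (inside  ∷ A) (inside  ∷ B) eq = cong (inside ∷_) (indicator-injective A B (proj₂ (∷-injective eq)))
indicator-injective (outside ∷ A) (inside  ∷ B) ()
indicator-injective (inside  ∷ A) (outside ∷ B) ()

lookup-indicator≤1 : ∀ {k} (A : Subset k) i → lookup (indicator A) i ≤ 1
lookup-indicator≤1 (outside ∷ A) zero    = z≤n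
lookup-indicator≤1 (inside  ∷ A) zero    = s≤s z≤n
lookup-indicator≤1 (_       ∷ A) (suc i) = lookup-indicator≤1 A i

subsets : ∀ {k} → Subset k → List (Subset k)
subsets []            = [ [] ]
subsets (outside ∷ X) = map (outside ∷_) (subsets X)
subsets (inside  ∷ X) = map (outside ∷_) (subsets X) ++ map (inside ∷_) (subsets X)

length-subsets : ∀ {k} (X : Subset k) → length (subsets X) ≡ 2 ^ ∣ X ∣
length-subsets []            = refl
length-subsets (outside ∷ X) = trans (length-map (outside ∷_) (subsets X)) (length-subsets X)
length-subsets (inside  ∷ X) =
  trans (length-++ (map (outside ∷_) (subsets X)))
        (cong₂ _+_ (half outside) (trans (half inside) (sym (ℕ.+-identityʳ _))))
  where
  half : ∀ b → length (map (b ∷_) (subsets X)) ≡ 2 ^ ∣ X ∣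
  half b = trans (length-map (b ∷_) (subsets X)) (length-subsets X)

∈-subsets⁺ : ∀ {k} {A X : Subset k} → A ⊆ X → A ∈ subsets X
∈-subsets⁺ {A = []}          {[]}          A⊆X = here refl
∈-subsets⁺ {A = outside ∷ A} {outside ∷ X} A⊆X = ∈-map⁺ (outside ∷_) (∈-subsets⁺ (drop-∷-⊆ A⊆X))
∈-subsets⁺ {A = inside  ∷ A} {outside ∷ X} A⊆X with () ← A⊆X here
∈-subsets⁺ {A = outside ∷ A} {inside  ∷ X} A⊆X = ∈-++⁺ˡ (∈-map⁺ (outside ∷_) (∈-subsets⁺ (drop-∷-⊆ A⊆X)))
∈-subsets⁺ {A = inside  ∷ A} {inside  ∷ X} A⊆X =
  ∈-++⁺ʳ (map (outside ∷_) (subsets X)) (∈-map⁺ (inside ∷_) (∈-subsets⁺ (drop-∷-⊆ A⊆X)))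

∈-subsets⁻ : ∀ {k} (X : Subset k) {A} → A ∈ subsets X → A ⊆ X
∈-subsets⁻ []            (here refl) i∈ = i∈
∈-subsets⁻ (outside ∷ X) A∈ i∈ with ∈-map⁻ (outside ∷_) A∈
∈-subsets⁻ (outside ∷ X) A∈ (there i∈) | B , B∈ , refl = there (∈-subsets⁻ X B∈ i∈)
∈-subsets⁻ (inside ∷ X)  A∈ here = here
∈-subsets⁻ (inside ∷ X)  A∈ (there i∈) with ∈-++⁻ (map (outside ∷_) (subsets X)) A∈
... | inj₁ A∈ˡ with ∈-map⁻ (outside ∷_) A∈ˡ
...   | B , B∈ , refl = there (∈-subsets⁻ X B∈ i∈)
∈-subsets⁻ (inside ∷ X)  A∈ (there i∈) | inj₂ A∈ʳ with ∈-map⁻ (inside ∷_) A∈ʳ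
...   | B , B∈ , refl = there (∈-subsets⁻ X B∈ i∈)

subsets-unique : ∀ {k} (X : Subset k) → Unique (subsets X)
subsets-unique []            = [] ∷ []
subsets-unique (outside ∷ X) = Unique.map⁺ (λ { refl → refl }) (subsets-unique X)
subsets-unique (inside  ∷ X) =
  Unique.++⁺ (Unique.map⁺ (λ { refl → refl }) (subsets-unique X))
             (Unique.map⁺ (λ { refl → refl }) (subsets-unique X))
             disjoint
  where
  disjoint : ∀ {A} → ¬ (A ∈ map (outside ∷_) (subsets X) × A ∈ map (inside ∷_) (subsets X))
  disjoint (A∈ , A∈′) with ∈-map⁻ (outside ∷_) A∈ | ∈-map⁻ (inside ∷_) A∈′
  ... | _ , _ , refl | _ , _ , ()

elements : ∀ {k} → Subset k → List (Fin k)
elements []            = []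
elements (outside ∷ A) = map suc (elements A)
elements (inside  ∷ A) = zero ∷ map suc (elements A)

length-elements : ∀ {k} (A : Subset k) → length (elements A) ≡ ∣ A ∣
length-elements []            = refl
length-elements (outside ∷ A) = trans (length-map suc (elements A)) (length-elements A)
length-elements (inside  ∷ A) = cong suc (trans (length-map suc (elements A)) (length-elements A))

elements⊆ : ∀ {k} (A : Subset k) → All (Subset._∈ A) (elements A)
elements⊆ []            = []
elements⊆ (outside ∷ A) = All.map⁺ (All.map there (elements⊆ A))
elements⊆ (inside  ∷ A) = here ∷ All.map⁺ (All.map there (elements⊆ A))

elements-unique : ∀ {k} (A : Subset k) → Unique (elements A)
elements-unique []            = []
elements-unique (outside ∷ A) = Unique.map⁺ suc-injective (elements-unique A)
elements-unique (inside  ∷ A) =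
  All.map⁺ (All.universal (λ _ ()) (elements A)) ∷ Unique.map⁺ suc-injective (elements-unique A)

unitVector : ∀ {k} → Fin k → Vec ℕ k
unitVector {k} i = replicate k 0 [ i ]≔ 1

exponents : ∀ {k} → List (Fin k) → Vec ℕ k
exponents {k} []       = replicate k 0
exponents     (i ∷ is) = zipWith _+_ (unitVector i) (exponents is)

exponents-map-suc : ∀ {k} (is : List (Fin k)) → exponents (map suc is) ≡ 0 ∷ exponents is
exponents-map-suc []       = refl
exponents-map-suc (i ∷ is) = cong (zipWith _+_ (unitVector (suc i))) (exponents-map-suc is)

exponents-elements : ∀ {k} (A : Subset k) → exponents (elements A) ≡ indicator A
exponents-elements []            = refl
exponents-elements (outside ∷ A) =
  trans (exponents-map-suc (elements A)) (cong (0 ∷_) (exponents-elements A))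
exponents-elements (inside  ∷ A) =
  trans (cong (zipWith _+_ (unitVector zero)) (exponents-map-suc (elements A)))
        (cong (1 ∷_) (trans (zipWith-identityˡ ℕ.+-identityˡ _) (exponents-elements A)))

indicator-⊥ : ∀ k → replicate k 0 ≡ indicator Subset.⊥
indicator-⊥ zero    = refl
indicator-⊥ (suc k) = cong (0 ∷_) (indicator-⊥ k)

indicator-⁅⁆ : ∀ {k} (i : Fin k) → unitVector i ≡ indicator ⁅ i ⁆
indicator-⁅⁆ zero    = cong (1 ∷_) (indicator-⊥ _)
indicator-⁅⁆ (suc i) = cong (0 ∷_) (indicator-⁅⁆ i)

unitVector+indicator : ∀ {k} i (A : Subset k) → ¬ i Subset.∈ A →
                       zipWith _+_ (unitVector i) (indicator A) ≡ indicator (A [ i ]≔ inside)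
unitVector+indicator zero    (outside ∷ A) i∉A = cong (1 ∷_) (zipWith-identityˡ ℕ.+-identityˡ _)
unitVector+indicator zero    (inside  ∷ A) i∉A = contradiction here i∉A
unitVector+indicator (suc i) (b ∷ A)       i∉A =
  cong (_ ∷_) (unitVector+indicator i A (i∉A ∘ there))

∈-[]≔-inside⁻ : ∀ {k} i (A : Subset k) {j} → j Subset.∈ A [ i ]≔ inside → j ≢ i → j Subset.∈ A
∈-[]≔-inside⁻ zero    (_ ∷ A) here       j≢i = contradiction refl j≢i
∈-[]≔-inside⁻ zero    (_ ∷ A) (there j∈) j≢i = there j∈
∈-[]≔-inside⁻ (suc i) (_ ∷ A) here       j≢i = here
∈-[]≔-inside⁻ (suc i) (_ ∷ A) (there j∈) j≢i = there (∈-[]≔-inside⁻ i A j∈ (j≢i ∘ cong suc))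

-- Each further variable is fresh, so its unit vector turns a 0 into a 1 and never a 1 into a 2.
-- Through this lemma, the absence of repetitions on a path becomes multilinearity of the
-- polynomial.
exponents-unique : ∀ {k} {is : List (Fin k)} → Unique is →
                   ∃ λ A → exponents is ≡ indicator A × (∀ {j} → j Subset.∈ A → j ∈ is)
exponents-unique {k} [] = Subset.⊥ , indicator-⊥ k , λ j∈ → contradiction j∈ ∉⊥
exponents-unique {is = i ∷ is} (i∉is ∷ uniq) with exponents-unique uniq
... | A , eq , A⊆is = A [ i ]≔ inside
  , trans (cong (zipWith _+_ (unitVector i)) eq)
          (unitVector+indicator i A λ i∈A → All.lookup i∉is (A⊆is i∈A) refl)
  , member
  where
  member : ∀ {j} → j Subset.∈ A [ i ]≔ inside → j ∈ i ∷ is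
  member {j} j∈ with j ≟ i
  ... | yes refl = here refl
  ... | no  j≢i  = there (A⊆is (∈-[]≔-inside⁻ i A j∈ j≢i))

-- Multilinear polynomials written out as sums of monomials.

module Monomials {c ℓ₁ ℓ₂} (F : HeytingField c ℓ₁ ℓ₂) (n : ℕ) where

  open OverField F
  open Polynomials F n
  private module F = HeytingField F

  monomial : F.Carrier → Subset n → Π-Formula n
  monomial a A = const a ∷ map var (elements A)

  ⟦monomial⟧ : ∀ a A → ⟦ monomial a A ⟧Π ≋ [ a , indicator A ]
  ⟦monomial⟧ a A with vars (elements A)
    where
    vars : ∀ is → ∃ λ b → ⟦ map var is ⟧Π ≡ [ b , exponents is ] × b F.≈ F.1#
    vars []       = F.1# , refl , F.refl
    vars (i ∷ is) with vars is
    ... | b , eq , b≈1 = F.1# F.* b , cong (varₚ i *ₚ_) eq , F.trans (F.*-identityˡ b) b≈1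
  ... | b , eq , b≈1 rewrite eq =
    ( F.trans (F.*-congˡ b≈1) (F.*-identityʳ a)
    , trans (zipWith-identityˡ ℕ.+-identityˡ _) (exponents-elements A)) ∷ []

  -- Every subset gets its monomial, even with coefficient zero, because equality with zero in the
  -- field need not be decidable. The size depends on `X` alone, however many terms the list `p`
  -- has.
  collect : Poly n → Subset n → ΣΠ-Formula n
  collect p X = map (λ A → monomial (coeff p (indicator A)) A) (subsets X)

  ⟦collect⟧ : ∀ p As → ⟦ map (λ A → monomial (coeff p (indicator A)) A) As ⟧ΣΠ
                     ≋ map (λ A → coeff p (indicator A) , indicator A) As
  ⟦collect⟧ p []       = []
  ⟦collect⟧ p (A ∷ As) = Pointwise.++⁺ (⟦monomial⟧ (coeff p (indicator A)) A) (⟦collect⟧ p As)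

  coeff-family : ∀ (g : Subset n → F.Carrier) {As A} → Unique As → A ∈ As →
                 coeff (map (λ A → g A , indicator A) As) (indicator A) F.≈ g A
  coeff-family g {A ∷ As} (A∉ ∷ _) (here refl) =
    F.trans (F.reflexive (coeff-∷-≡ {e = indicator A} (map (λ A → g A , indicator A) As) refl))
   (F.trans (F.+-congˡ (coeff-absent (All.map⁺ (All.map distinct A∉)))) (F.+-identityʳ (g A)))
    where
    distinct : ∀ {B} → A ≢ B → indicator B ≢ indicator A
    distinct A≢B eq = A≢B (indicator-injective _ _ (sym eq))
  coeff-family g {B ∷ As} {A} (B∉ ∷ uniq) (there A∈) =
    F.trans (F.reflexive (coeff-∷-≢ (map (λ A → g A , indicator A) As)
                                    λ eq → All.lookup B∉ A∈ (indicator-injective B A eq)))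
            (coeff-family g uniq A∈)

  -- A condition on the listed terms, including those that cancel in the sum; this lets it be
  -- checked path by path.
  SupportedBy : Subset n → Poly n → Set _
  SupportedBy X = All λ t → ∃ λ A → A ⊆ X × proj₂ t ≡ indicator A

  -- At the indicator of a subset of `X` exactly one collected monomial contributes, and it carries
  -- the coefficient of `p`. At any other exponent vector neither side has a term.
  ⟦collect⟧-correct : ∀ {p X} → SupportedBy X p → ⟦ collect p X ⟧ΣΠ ≃ p
  ⟦collect⟧-correct {p} {X} supp =
    ≃-trans (≋⇒≃ (⟦collect⟧ p (subsets X))) (coefficientwise agree)
    where
    agree : map (λ A → coeff p (indicator A) , indicator A) (subsets X) ≈ₚ p
    agree m with any? (λ A → ≡-dec ℕ._≟_ (indicator A) m) (subsets X)
    ... | yes m∈ with find m∈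
    ...   | A , A∈ , refl = coeff-family (λ A → coeff p (indicator A)) (subsets-unique X) A∈
    agree m | no m∉ = F.trans
      (coeff-absent (All.map⁺ (All.¬Any⇒All¬ _ m∉)))
      (F.sym (coeff-absent (All.map (λ { (A , A⊆X , eq) eq′ → m∉ (lose (∈-subsets⁺ A⊆X) (trans (sym eq) eq′)) }) supp)))

  collect-multilinear : ∀ p X → Multilinear ⟦ collect p X ⟧ΣΠ
  collect-multilinear p X m i 2≤mᵢ = F.trans
    (coeff-cong (≋⇒≃ (⟦collect⟧ p (subsets X))) m)
    (coeff-absent (All.map⁺ (All.universal
      (λ { A refl → ℕ.<-irrefl refl (ℕ.≤-trans 2≤mᵢ (lookup-indicator≤1 A i)) }) (subsets X))))

  varsΣΠ-collect : ∀ p X → varsΣΠ (collect p X) ⊆ X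
  varsΣΠ-collect p X = ⋃⊆ (All.map⁺ (All.map⁺ (All.tabulate (varsΠ-monomial ∘ ∈-subsets⁻ X))))
    where
    leaves : ∀ {A} → A ⊆ X → All (λ i → ⁅ i ⁆ ⊆ X) (elements A)
    leaves {A} A⊆X = All.map (λ i∈A {_} → ⁅⁆⊆ (A⊆X i∈A)) (elements⊆ A)

    varsΠ-monomial : ∀ {A} → A ⊆ X → varsΠ (monomial (coeff p (indicator A)) A) ⊆ X
    varsΠ-monomial A⊆X = ⋃⊆ (⊥⊆ ∷ All.map⁺ (All.map⁺ (leaves A⊆X)))

  collect-disjoint : ∀ p X → All (λ M → PairwiseDisjoint (map varsLabel M)) (collect p X)
  collect-disjoint p X = All.map⁺ (All.universal disjoint (subsets X))
    where
    disjoint : ∀ A → PairwiseDisjoint (map varsLabel (monomial (coeff p (indicator A)) A))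
    disjoint A =
      All.universal (λ B (_ , i∈) → ∉⊥ (proj₁ (x∈p∩q⁻ Subset.⊥ B i∈))) _
      ∷ AllPairs.map⁺ (AllPairs.map⁺ (AllPairs.map
          (λ i≢j (_ , x∈) → i≢j (trans (sym (x∈⁅y⁆⇒x≡y _ (proj₁ (x∈p∩q⁻ _ _ x∈))))
                                        (x∈⁅y⁆⇒x≡y _ (proj₂ (x∈p∩q⁻ _ _ x∈)))))
          (elements-unique A)))

  sizeΣΠ-collect : ∀ p X → sizeΣΠ (collect p X) ≤ suc (2 ^ ∣ X ∣ * (2 + ∣ X ∣))
  sizeΣΠ-collect p X = s≤s (subst (λ l → sum (map sizeΠ (collect p X)) ≤ l * (2 + ∣ X ∣))
    (trans (length-map _ (subsets X)) (length-subsets X))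
    (sum-≤ sizeΠ (All.map⁺ (All.tabulate λ {A} A∈ →
      s≤s (s≤s (subst (_≤ ∣ X ∣) (sym (trans (length-map var (elements A)) (length-elements A)))
                      (p⊆q⇒∣p∣≤∣q∣ (∈-subsets⁻ X A∈))))))))

  labelₚ-supported : ∀ l → SupportedBy (varsLabel l) (labelₚ l)
  labelₚ-supported (var i)   = (⁅ i ⁆ , id , indicator-⁅⁆ i) ∷ []
  labelₚ-supported (const a) = (Subset.⊥ , id , indicator-⊥ n) ∷ []

-- Unions of singletons, disjoint subsets and repetition-free lists.

∈-⋃-⁅⁆⁺ : ∀ {k} {i : Fin k} {is} → i ∈ is → i Subset.∈ ⋃ (map ⁅_⁆ is)
∈-⋃-⁅⁆⁺ (here refl) = x∈p∪q⁺ (inj₁ (x∈⁅x⁆ _))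
∈-⋃-⁅⁆⁺ (there i∈)  = x∈p∪q⁺ (inj₂ (∈-⋃-⁅⁆⁺ i∈))

∈-⋃-⁅⁆⁻ : ∀ {k} {i : Fin k} is → i Subset.∈ ⋃ (map ⁅_⁆ is) → i ∈ is
∈-⋃-⁅⁆⁻ []       i∈ = contradiction i∈ ∉⊥
∈-⋃-⁅⁆⁻ (j ∷ is) i∈ =
  [ here ∘ x∈⁅y⁆⇒x≡y j , there ∘ ∈-⋃-⁅⁆⁻ is ]′ (x∈p∪q⁻ ⁅ j ⁆ (⋃ (map ⁅_⁆ is)) i∈)

∣∣-disjoint-⊆ : ∀ {k} {A B X : Subset k} → A ⊆ X → B ⊆ X →
                (∀ {i} → i Subset.∈ A → ¬ i Subset.∈ B) → ∣ A ∣ + ∣ B ∣ ≤ ∣ X ∣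
∣∣-disjoint-⊆ {A = []} {[]} {[]} A⊆X B⊆X A#B = z≤n
∣∣-disjoint-⊆ {A = inside ∷ A} {inside ∷ B} A⊆X B⊆X A#B = contradiction here (A#B here)
∣∣-disjoint-⊆ {A = inside ∷ A} {_ ∷ B} {outside ∷ X} A⊆X B⊆X A#B with () ← A⊆X here
∣∣-disjoint-⊆ {A = _ ∷ A} {inside ∷ B} {outside ∷ X} A⊆X B⊆X A#B with () ← B⊆X here
∣∣-disjoint-⊆ {A = inside ∷ A} {outside ∷ B} {inside ∷ X} A⊆X B⊆X A#B =
  s≤s (∣∣-disjoint-⊆ (drop-∷-⊆ A⊆X) (drop-∷-⊆ B⊆X) λ i∈A i∈B → A#B (there i∈A) (there i∈B))
∣∣-disjoint-⊆ {A = outside ∷ A} {inside ∷ B} {inside ∷ X} A⊆X B⊆X A#B =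
  subst (_≤ suc ∣ X ∣) (sym (ℕ.+-suc ∣ A ∣ ∣ B ∣))
    (s≤s (∣∣-disjoint-⊆ (drop-∷-⊆ A⊆X) (drop-∷-⊆ B⊆X) λ i∈A i∈B → A#B (there i∈A) (there i∈B)))
∣∣-disjoint-⊆ {A = outside ∷ A} {outside ∷ B} {inside ∷ X} A⊆X B⊆X A#B =
  ℕ.m≤n⇒m≤1+n (∣∣-disjoint-⊆ (drop-∷-⊆ A⊆X) (drop-∷-⊆ B⊆X) λ i∈A i∈B → A#B (there i∈A) (there i∈B))
∣∣-disjoint-⊆ {A = outside ∷ A} {outside ∷ B} {outside ∷ X} A⊆X B⊆X A#B =
  ∣∣-disjoint-⊆ (drop-∷-⊆ A⊆X) (drop-∷-⊆ B⊆X) λ i∈A i∈B → A#B (there i∈A) (there i∈B)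

Unique-++⁻ : ∀ {a} {A : Set a} (xs : List A) {ys} → Unique (xs ++ ys) →
             Unique xs × Unique ys × List.Disjoint xs ys
Unique-++⁻ []       uniq = [] , uniq , λ { (() , _) }
Unique-++⁻ (x ∷ xs) (x∉ ∷ uniq) with Unique-++⁻ xs uniq
... | uniqˡ , uniqʳ , disjoint = All.++⁻ˡ xs x∉ ∷ uniqˡ , uniqʳ , λ
  { (here refl , ∈ys) → All.lookup (All.++⁻ʳ xs x∉) ∈ys refl
  ; (there ∈xs , ∈ys) → disjoint (∈xs , ∈ys) }

-- Paths of the program and the variables between two nodes.

module Programs {c ℓ₁ ℓ₂} (F : HeytingField c ℓ₁ ℓ₂) {n S : ℕ} (P : OverField.ABP F n S) where

  open OverField F
  open ABP P
  open Polynomials F n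
  open Monomials F n using (SupportedBy)
  private
    module F = HeytingField F
    module Pₚ = CommutativeSemiring +ₚ-*ₚ-commutativeSemiring

  level : Fin S → ℕ
  level v = toℕ (layer v)

  distance : Fin S → Fin S → ℕ
  distance u v = level v ∸ level u

  infixr 5 _++ᵖ_
  _++ᵖ_ : ∀ {u v w} → Path u v → Path v w → Path u w
  []      ++ᵖ q = q
  (e ∷ p) ++ᵖ q = e ∷ (p ++ᵖ q)

  variables-++ᵖ : ∀ {u v w} (p : Path u v) (q : Path v w) →
                  variables (p ++ᵖ q) ≡ variables p ++ variables q
  variables-++ᵖ []                  q = refl
  variables-++ᵖ ((var i   , _) ∷ p) q = cong (i ∷_) (variables-++ᵖ p q)
  variables-++ᵖ ((const _ , _) ∷ p) q = variables-++ᵖ p q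

  pathLength≡distance : ∀ {u v} (p : Path u v) → pathLength p ≡ distance u v
  pathLength≡distance {u} p =
    sym (trans (cong (_∸ level u) (layer-path p)) (ℕ.m+n∸m≡n (level u) (pathLength p)))

  -- One length suffices, since the layering gives all paths from `u` to `v` the same length. If `v`
  -- does not lie on a later layer, the truncated `distance` is 0 and only u = v yields a path.
  paths : ∀ u v → List (Path u v)
  paths u v = pathsOfLength (distance u v) u v

  ∈-paths : ∀ {u v} (p : Path u v) → p ∈ paths u v
  ∈-paths {u} {v} p = subst (λ k → p ∈ pathsOfLength k u v) (pathLength≡distance p) (∈-pathsOfLength p)

  path? : ∀ u v → Dec (Path u v)
  path? u v with paths u v | ∈-paths {u} {v}
  ... | []    | complete = no λ p → contradiction (complete p) λ ()
  ... | p ∷ _ | _        = yes p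

  edge? : ∀ u v → Dec (Edge u v)
  edge? u v with edge u v
  ... | just l  = yes (l , refl)
  ... | nothing = no λ ()

  ¬Edge⇒nothing : ∀ {u v} → ¬ Edge u v → edge u v ≡ nothing
  ¬Edge⇒nothing {u} {v} ¬e with edge u v
  ... | just l  = contradiction (l , refl) ¬e
  ... | nothing = refl

  -- Every node other than `s` has an incoming edge, and going back along it lowers the layer.
  -- Together with `reaches-t` this extends any path to one from `s` to `t`, the only paths of which
  -- `SyntacticMultilinear` speaks.
  s-reaches : ∀ v → Path s v
  s-reaches v = go (level v) v ℕ.≤-refl
    where
    go : ∀ k v → level v ≤ k → Path s v
    go k v lv≤k with v ≟ s
    ... | yes refl = []
    ... | no  v≢s with Fin.any? (λ u → edge? u v)
    ...   | no  ¬e = contradiction (Equivalence.to (source v) λ u → ¬Edge⇒nothing λ e → ¬e (u , e)) v≢s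
    go zero v lv≤0 | no v≢s | yes _ =
      contradiction (Equivalence.to (first v) (toℕ-injective (ℕ.n≤0⇒n≡0 lv≤0))) v≢s
    go (suc k) v lv≤k | no v≢s | yes (u , e) =
      go k u (s≤s⁻¹ (subst (_≤ suc k) (edge-layer (proj₂ e)) lv≤k)) ++ᵖ (e ∷ [])

  level≤depth : ∀ v → level v ≤ depth
  level≤depth v = toℕ≤pred[n] (layer v)

  level-t : level t ≡ depth
  level-t = trans (cong toℕ (Equivalence.from (last t) refl)) (toℕ-fromℕ depth)

  reaches-t : ∀ v → Path v t
  reaches-t v = go depth v (ℕ.m≤n+m depth (level v))
    where
    go : ∀ k v → depth ≤ level v + k → Path v t
    go k v d≤ with v ≟ t
    ... | yes refl = []
    ... | no  v≢t with Fin.any? (edge? v)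
    ...   | no  ¬e = contradiction (Equivalence.to (sink v) λ u → ¬Edge⇒nothing λ e → ¬e (u , e)) v≢t
    go zero v d≤ | no v≢t | yes _ =
      contradiction (Equivalence.to (last v) (toℕ-injective (trans
        (ℕ.≤-antisym (level≤depth v) (subst (depth ≤_) (ℕ.+-identityʳ _) d≤))
        (sym (toℕ-fromℕ depth))))) v≢t
    go (suc k) v d≤ | no v≢t | yes (w , e) =
      e ∷ go k w (subst (depth ≤_) (trans (ℕ.+-suc _ k) (cong (_+ k) (sym (edge-layer (proj₂ e))))) d≤)

  -- The X(u,v) of the overview. It is empty when `v` cannot be reached from `u`.
  Vars : Fin S → Fin S → Subset n
  Vars u v = ⋃ (map ⁅_⁆ (concatMap variables (paths u v)))

  ∈-Vars⁺ : ∀ {u v i} (p : Path u v) → i ∈ variables p → i Subset.∈ Vars u v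
  ∈-Vars⁺ p i∈ = ∈-⋃-⁅⁆⁺ (∈-concatMap⁺ variables (lose (∈-paths p) i∈))

  ∈-Vars⁻ : ∀ {u v i} → i Subset.∈ Vars u v → ∃ λ (p : Path u v) → i ∈ variables p
  ∈-Vars⁻ {u} {v} i∈ with find (∈-concatMap⁻ variables {paths u v} (∈-⋃-⁅⁆⁻ _ i∈))
  ... | p , _ , i∈p = p , i∈p

  Vars-monoʳ : ∀ {u v w} → Path v w → Vars u v ⊆ Vars u w
  Vars-monoʳ q i∈ with ∈-Vars⁻ i∈
  ... | p , i∈p = ∈-Vars⁺ (p ++ᵖ q) (subst (_ ∈_) (sym (variables-++ᵖ p q)) (∈-++⁺ˡ i∈p))

  Vars-monoˡ : ∀ {u v w} → Path u v → Vars v w ⊆ Vars u w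
  Vars-monoˡ p i∈ with ∈-Vars⁻ i∈
  ... | q , i∈q = ∈-Vars⁺ (p ++ᵖ q) (subst (_ ∈_) (sym (variables-++ᵖ p q)) (∈-++⁺ʳ (variables p) i∈q))

  varsLabel⊆Vars : ∀ {u v l} → edge u v ≡ just l → varsLabel l ⊆ Vars u v
  varsLabel⊆Vars {l = var i}   eq = ⁅⁆⊆ (∈-Vars⁺ ((var i , eq) ∷ []) (here refl))
  varsLabel⊆Vars {l = const _} eq = ⊥⊆

  ∣Vars-self∣ : ∀ u → ∣ Vars u u ∣ ≡ 0
  ∣Vars-self∣ u rewrite ℕ.n∸n≡0 (level u) with u ≟ u
  ... | yes refl = ∣⊥∣≡0 n
  ... | no  u≢u  = contradiction refl u≢u

  module _ (multilinear : SyntacticMultilinear) where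

    -- The path is the middle part of a path from `s` to `t`, and a sublist inherits the absence of
    -- repetitions.
    variables-unique : ∀ {u v} (p : Path u v) → Unique (variables p)
    variables-unique {u} {v} p = proj₁ (Unique-++⁻ (variables p)
      (subst Unique (variables-++ᵖ p (reaches-t v))
      (proj₁ (proj₂ (Unique-++⁻ (variables (s-reaches u))
        (subst Unique (variables-++ᵖ (s-reaches u) (p ++ᵖ reaches-t v))
          (multilinear (s-reaches u ++ᵖ p ++ᵖ reaches-t v))))))))

    Vars-disjoint : ∀ {u v w i} → i Subset.∈ Vars u v → ¬ i Subset.∈ Vars v w
    Vars-disjoint i∈ i∈′ with ∈-Vars⁻ i∈ | ∈-Vars⁻ i∈′
    ... | p , i∈p | q , i∈q =
      proj₂ (proj₂ (Unique-++⁻ (variables p)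
        (subst Unique (variables-++ᵖ p q) (variables-unique (p ++ᵖ q))))) (i∈p , i∈q)

    ∣Vars∣-superadditive : ∀ {u v w} → Path u v → Path v w →
                           ∣ Vars u v ∣ + ∣ Vars v w ∣ ≤ ∣ Vars u w ∣
    ∣Vars∣-superadditive p q = ∣∣-disjoint-⊆ (Vars-monoʳ q) (Vars-monoˡ p) Vars-disjoint

  -- Sums over walks inside a set of nodes, and the decomposition at the first exit.

  vertices : List (Fin S)
  vertices = allFin S

  adjacency : Fin S → Fin S → Poly n
  adjacency x y = maybe′ labelₚ [] (edge x y)

  arc : (Fin S → Bool) → Fin S → Fin S → Poly n
  arc W x y = if W y then adjacency x y else []

  arc-just : ∀ W x y {l} → W y ≡ true → edge x y ≡ just l → arc W x y ≡ labelₚ l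
  arc-just W x y Wy eq rewrite Wy | eq = refl

  arc-false : ∀ W x y → W y ≡ false → arc W x y ≡ []
  arc-false W x y ¬Wy rewrite ¬Wy = refl

  arc-nothing : ∀ W x y → edge x y ≡ nothing → arc W x y ≡ []
  arc-nothing W x y eq rewrite eq with W y
  ... | true  = refl
  ... | false = refl

  -- The (x,y) entry of the k-th power of the adjacency matrix with the columns outside `W` set to
  -- zero. The starting node itself is not restricted to `W`, only the nodes entered later.
  walks : (Fin S → Bool) → ℕ → Fin S → Fin S → Poly n
  walks W zero    x y = if does (x ≟ y) then constₚ F.1# else []
  walks W (suc k) x y = ∑ vertices λ z → arc W x z *ₚ walks W k z y

  connection : (Fin S → Bool) → Fin S → Fin S → Poly n
  connection W x y = walks W (distance x y) x y

  everywhere : Fin S → Bool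
  everywhere _ = true

  toSink : Fin S → Poly n
  toSink x = connection everywhere x t

  walks-zero-≢ : ∀ W x y → x ≢ y → walks W 0 x y ≡ []
  walks-zero-≢ W x y x≢y with x ≟ y
  ... | yes x≡y = contradiction x≡y x≢y
  ... | no  _   = refl

  walks-zero-refl : ∀ W x → walks W 0 x x ≡ constₚ F.1#
  walks-zero-refl W x with x ≟ x
  ... | yes _   = refl
  ... | no  x≢x = contradiction refl x≢x

  -- Every arc that counts ends in `W`, so a walk starting there cannot leave. This discards the cut
  -- nodes outside `W`.
  walks-outside : ∀ W k {x y} → W x ≡ true → W y ≡ false → walks W k x y ≃ []
  walks-outside W zero {x} {y} Wx ¬Wy = ≃-reflexive (walks-zero-≢ W x y x≢y)
    where
    x≢y : x ≢ y
    x≢y refl with () ← trans (sym Wx) ¬Wy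
  walks-outside W (suc k) {x} {y} Wx ¬Wy = ∑-zero vertices (All.universal vanish vertices)
    where
    vanish : ∀ z → arc W x z *ₚ walks W k z y ≃ []
    vanish z with W z in Wz
    ... | true  = ≃-trans (*ₚ-congˡ (adjacency x z) (walks-outside W k Wz ¬Wy)) (*ₚ-zeroʳ (adjacency x z))
    ... | false = ≃-refl

  -- The arc is zero unless an edge from `x` to `z` enters `W`, so both facts about `z` may be
  -- assumed when comparing what follows it.
  arc-*ₚ-cong : ∀ W x z {p q} → (W z ≡ true → level z ≡ suc (level x) → p ≃ q) →
                arc W x z *ₚ p ≃ arc W x z *ₚ q
  arc-*ₚ-cong W x z p≃q with W z | edge x z in eq
  ... | true  | just l  = *ₚ-congˡ (labelₚ l) (p≃q refl (edge-layer eq))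
  ... | true  | nothing = ≃-refl
  ... | false | _       = ≃-refl

  -- In matrix form G = I + A G, with A the adjacency matrix restricted to `W`. At most one summand
  -- survives: if `y` lies on a later layer, then x ≠ y kills the identity part; otherwise every
  -- successor of `x` lies beyond the layer of `y` and cannot connect to it.
  connection-unfold : ∀ W x y → connection W x y ≃
                      walks W 0 x y +ₚ ∑ vertices (λ z → arc W x z *ₚ connection W z y)
  connection-unfold W x y with level x ℕ.<? level y
  ... | yes lx<ly = ≃-trans
    (≃-reflexive (cong (λ k → walks W k x y) (ℕ.+-∸-assoc 1 lx<ly)))
    (≃-trans (∑-cong vertices λ z → arc-*ₚ-cong W x z λ _ lz≡ →
               ≃-reflexive (cong (λ l → walks W (level y ∸ l) z y) (sym lz≡)))
             (+ₚ-cong (≃-reflexive (sym (walks-zero-≢ W x y λ { refl → ℕ.<-irrefl refl lx<ly }))) ≃-refl))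
  ... | no  lx≮ly = ≃-trans
    (≃-reflexive (cong (λ k → walks W k x y) (ℕ.m≤n⇒m∸n≡0 ly≤lx)))
    (≃-trans (≃-sym (Pₚ.+-identityʳ _)) (+ₚ-cong ≃-refl (≃-sym (∑-zero vertices (All.universal vanish vertices)))))
    where
    ly≤lx : level y ≤ level x
    ly≤lx = ℕ.≮⇒≥ lx≮ly

    beyond : ∀ {z} → level z ≡ suc (level x) → connection W z y ≡ []
    beyond {z} lz≡ = trans
      (cong (λ k → walks W k z y) (ℕ.m≤n⇒m∸n≡0 (ℕ.<⇒≤ ly<lz)))
      (walks-zero-≢ W z y λ { refl → ℕ.<-irrefl refl ly<lz })
      where
      ly<lz : level y < level z
      ly<lz = subst (level y <_) (sym lz≡) (s≤s ly≤lx)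

    vanish : ∀ z → arc W x z *ₚ connection W z y ≃ []
    vanish z = ≃-trans (arc-*ₚ-cong W x z λ _ lz≡ → ≃-reflexive (beyond lz≡)) (*ₚ-zeroʳ (arc W x z))

  module _ (W : Fin S → Bool) where

    exits : Fin S → Poly n
    exits w = ∑ vertices λ v → arc (not ∘ W) w v *ₚ toSink v

    exits+stays : ∀ x → ∑ vertices (λ z → adjacency x z *ₚ toSink z) ≃
                        exits x +ₚ ∑ vertices (λ z → arc W x z *ₚ toSink z)
    exits+stays x = ≃-trans (∑-cong vertices split)
      (∑-distrib-+ vertices (λ z → arc (not ∘ W) x z *ₚ toSink z) (λ z → arc W x z *ₚ toSink z))
      where
      split : ∀ z → adjacency x z *ₚ toSink z ≃ arc (not ∘ W) x z *ₚ toSink z +ₚ arc W x z *ₚ toSink z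
      split z with W z
      ... | true  = ≃-refl
      ... | false = ≃-sym (Pₚ.+-identityʳ _)

    viaExits : Fin S → Poly n
    viaExits x = ∑ vertices λ w → connection W x w *ₚ exits w

    -- This is `connection-unfold` multiplied by the vector of `exits`. By `exits+stays`, `toSink`
    -- obeys the same recursion at nodes of `W` when `t` is outside; as arcs go up the layers, the
    -- recursion determines its solution, which gives `first-exit`.
    viaExits-unfold : ∀ x → viaExits x ≃ exits x +ₚ ∑ vertices (λ z → arc W x z *ₚ viaExits z)
    viaExits-unfold x = begin
      viaExits x
        ≈⟨ ∑-cong vertices (λ w → ≃-trans
             (*ₚ-cong (connection-unfold W x w) (≃-refl {exits w}))
             (*ₚ-distribʳ-+ₚ (exits w) (walks W 0 x w) (∑ vertices (λ z → arc W x z *ₚ connection W z w)))) ⟩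
      ∑ vertices (λ w → walks W 0 x w *ₚ exits w +ₚ ∑ vertices (λ z → arc W x z *ₚ connection W z w) *ₚ exits w)
        ≈⟨ ∑-distrib-+ vertices (λ w → walks W 0 x w *ₚ exits w)
                       (λ w → ∑ vertices (λ z → arc W x z *ₚ connection W z w) *ₚ exits w) ⟩
      ∑ vertices (λ w → walks W 0 x w *ₚ exits w)
        +ₚ ∑ vertices (λ w → ∑ vertices (λ z → arc W x z *ₚ connection W z w) *ₚ exits w)
        ≈⟨ +ₚ-cong exitNow exitLater ⟩
      exits x +ₚ ∑ vertices (λ z → arc W x z *ₚ viaExits z) ∎
      where
      open SetoidReasoning Pₚ.setoid

      exitNow : ∑ vertices (λ w → walks W 0 x w *ₚ exits w) ≃ exits x
      exitNow = ≃-trans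
        (∑-single (Unique.allFin⁺ S) (∈-allFin x) λ w x≢w →
          ≃-reflexive (cong (_*ₚ exits w) (walks-zero-≢ W x w x≢w)))
        (≃-trans (≃-reflexive (cong (_*ₚ exits x) (walks-zero-refl W x))) (*ₚ-identityˡ (exits x)))

      exitLater : ∑ vertices (λ w → ∑ vertices (λ z → arc W x z *ₚ connection W z w) *ₚ exits w) ≃
                 ∑ vertices (λ z → arc W x z *ₚ viaExits z)
      exitLater = begin
        ∑ vertices (λ w → ∑ vertices (λ z → arc W x z *ₚ connection W z w) *ₚ exits w)
          ≈⟨ ∑-cong vertices (λ w → ≃-trans
               (*ₚ-distribʳ-∑ (exits w) vertices (λ z → arc W x z *ₚ connection W z w))
               (∑-cong vertices λ z → *ₚ-assoc (arc W x z) (connection W z w) (exits w))) ⟩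
        ∑ vertices (λ w → ∑ vertices (λ z → arc W x z *ₚ (connection W z w *ₚ exits w)))
          ≈⟨ ∑-swap vertices vertices (λ w z → arc W x z *ₚ (connection W z w *ₚ exits w)) ⟩
        ∑ vertices (λ z → ∑ vertices (λ w → arc W x z *ₚ (connection W z w *ₚ exits w)))
          ≈⟨ ∑-cong vertices (λ z → *ₚ-distribˡ-∑ (arc W x z) vertices (λ w → connection W z w *ₚ exits w)) ⟨
        ∑ vertices (λ z → arc W x z *ₚ viaExits z) ∎

    -- A path that starts in W and ends at t ∉ W leaves W for the first time along a unique edge.
    first-exit : W t ≡ false → ∀ {x} → W x ≡ true → toSink x ≃ viaExits x
    first-exit ¬Wt {x} = go (suc depth) x (ℕ.m≤n+m (suc depth) (level x))
      where
      go : ∀ k x → depth < level x + k → W x ≡ true → toSink x ≃ viaExits x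
      go zero    x d< Wx = contradiction (level≤depth x) (ℕ.<⇒≱ (subst (depth <_) (ℕ.+-identityʳ _) d<))
      go (suc k) x d< Wx = begin
        toSink x
          ≈⟨ connection-unfold everywhere x t ⟩
        walks everywhere 0 x t +ₚ ∑ vertices (λ z → adjacency x z *ₚ toSink z)
          ≈⟨ +ₚ-cong (≃-reflexive (walks-zero-≢ everywhere x t λ { refl → contradiction (trans (sym Wx) ¬Wt) λ () })) ≃-refl ⟩
        ∑ vertices (λ z → adjacency x z *ₚ toSink z)
          ≈⟨ exits+stays x ⟩
        exits x +ₚ ∑ vertices (λ z → arc W x z *ₚ toSink z)
          ≈⟨ +ₚ-cong ≃-refl (∑-cong vertices λ z → arc-*ₚ-cong W x z λ Wz lz≡ →
               go k z (subst (depth <_) (trans (ℕ.+-suc _ k) (cong (_+ k) (sym lz≡))) d<) Wz) ⟩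
        exits x +ₚ ∑ vertices (λ z → arc W x z *ₚ viaExits z)
          ≈⟨ viaExits-unfold x ⟨
        viaExits x ∎
        where open SetoidReasoning Pₚ.setoid

  -- Comparison of walk sums with sums over listed paths.

  ∑-edges : ∀ x z → ∑ (edges x z) (labelₚ ∘ proj₁) ≃ adjacency x z
  ∑-edges x z with edge x z
  ... | just l  = Pₚ.+-identityʳ (labelₚ l)
  ... | nothing = ≃-refl

  ∑-prepend : ∀ {x z y} (es : List (Edge x z)) (ps : List (Path z y)) →
              ∑ (cartesianProductWith _∷_ es ps) weight ≃ ∑ es (labelₚ ∘ proj₁) *ₚ ∑ ps weight
  ∑-prepend []       ps = ≃-refl
  ∑-prepend (e ∷ es) ps = begin
    ∑ (map (e ∷_) ps ++ cartesianProductWith _∷_ es ps) weight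
      ≡⟨ trans (cong Σₚ (map-++ weight (map (e ∷_) ps) _)) (∑-++ (map weight (map (e ∷_) ps)) _) ⟩
    ∑ (map (e ∷_) ps) weight +ₚ ∑ (cartesianProductWith _∷_ es ps) weight
      ≡⟨ cong (_+ₚ _) (∑-map weight (e ∷_) ps) ⟩
    ∑ ps (λ p → labelₚ (proj₁ e) *ₚ weight p) +ₚ ∑ (cartesianProductWith _∷_ es ps) weight
      ≈⟨ +ₚ-cong (≃-sym (*ₚ-distribˡ-∑ (labelₚ (proj₁ e)) ps weight)) (∑-prepend es ps) ⟩
    labelₚ (proj₁ e) *ₚ ∑ ps weight +ₚ ∑ es (labelₚ ∘ proj₁) *ₚ ∑ ps weight
      ≈⟨ *ₚ-distribʳ-+ₚ (∑ ps weight) (labelₚ (proj₁ e)) (∑ es (labelₚ ∘ proj₁)) ⟨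
    ∑ (e ∷ es) (labelₚ ∘ proj₁) *ₚ ∑ ps weight ∎
    where open SetoidReasoning Pₚ.setoid

  walks-paths : ∀ k x y → ∑ (pathsOfLength k x y) weight ≃ walks everywhere k x y
  walks-paths zero x y with x ≟ y
  ... | yes refl = Pₚ.+-identityʳ _
  ... | no  _    = ≃-refl
  walks-paths (suc k) x y = ≃-trans
    (≃-reflexive (∑-concatMap weight (λ z → cartesianProductWith _∷_ (edges x z) (pathsOfLength k z y)) vertices))
    (∑-cong vertices through)
    where
    through : ∀ z → ∑ (cartesianProductWith _∷_ (edges x z) (pathsOfLength k z y)) weight ≃
                    adjacency x z *ₚ walks everywhere k z y
    through z = ≃-trans (∑-prepend (edges x z) (pathsOfLength k z y))
                        (*ₚ-cong (∑-edges x z) (walks-paths k z y))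

  polynomial≃toSink : polynomial ≃ toSink s
  polynomial≃toSink = ≃-trans (walks-paths depth s t)
    (≃-reflexive (cong (λ k → walks everywhere k s t)
      (sym (cong₂ _∸_ level-t (cong toℕ (Equivalence.from (first s) refl))))))

  -- Coefficients and the restriction to `W` are forgotten: the support of a walk sum depends only
  -- on which variables its paths carry.
  IsPathTerm : Fin S → Fin S → Term → Set c
  IsPathTerm x y t = ∃ λ (p : Path x y) → proj₂ t ≡ exponents (variables p)

  walks-terms : ∀ W k x y → All (IsPathTerm x y) (walks W k x y)
  walks-terms W zero x y with x ≟ y
  ... | yes refl = ([] , refl) ∷ []
  ... | no  _    = []
  walks-terms W (suc k) x y = All.concat⁺ (All.map⁺ (All.universal through vertices))
    where
    through : ∀ z → All (IsPathTerm x y) (arc W x z *ₚ walks W k z y)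
    through z with W z | edge x z in eq
    ... | false | _            = []
    ... | true  | nothing      = []
    ... | true  | just (var i) = All.++⁺ (All.map⁺ (All.map
      (λ { (p , e≡) → (var i , eq) ∷ p , cong (zipWith _+_ (unitVector i)) e≡ }) (walks-terms W k z y))) []
    ... | true  | just (const a) = All.++⁺ (All.map⁺ (All.map
      (λ { (p , e≡) → (const a , eq) ∷ p , trans (zipWith-identityˡ ℕ.+-identityˡ _) e≡ }) (walks-terms W k z y))) []

  connection-supported : SyntacticMultilinear → ∀ W x y → SupportedBy (Vars x y) (connection W x y)
  connection-supported multilinear W x y = All.map (λ {t} → supported t) (walks-terms W (distance x y) x y)
    where
    supported : ∀ t → IsPathTerm x y t → ∃ λ A → A ⊆ Vars x y × proj₂ t ≡ indicator A
    supported t (p , e≡) with exponents-unique (variables-unique multilinear p)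
    ... | A , eq , A⊆p = A , ∈-Vars⁺ p ∘ A⊆p , trans e≡ eq

-- Greedy cutting of paths and the resulting sum of products.

module Expansion {c ℓ₁ ℓ₂} (F : HeytingField c ℓ₁ ℓ₂) {n S : ℕ} (P : OverField.ABP F n S)
                 (multilinear : OverField.ABP.SyntacticMultilinear P)
                 (r : ℕ) (1≤r : 1 ≤ r) where

  open OverField F
  open ABP P
  open Polynomials F n
  open Monomials F n
  open Programs F P
  private module Pₚ = CommutativeSemiring +ₚ-*ₚ-commutativeSemiring

  -- A sum gate over at most 2^r monomials, each made of a product gate, a coefficient leaf and at
  -- most r variable leaves.
  factorSize : ℕ
  factorSize = suc (2 ^ r * (2 + r))

  -- Besides the requirements of the formula class, `vars⊆` confines the factor to the variables
  -- between two nodes, the source of disjointness in `prefix`, and `smallFactor` feeds the size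
  -- count.
  record GoodFactor (X : Subset n) (Q : ΣΠ-Formula n) : Set (c Level.⊔ ℓ₁) where
    field
      multilinearΣΠ   : Multilinear ⟦ Q ⟧ΣΠ
      fewVars         : ∣ varsΣΠ Q ∣ ≤ r
      disjointLeaves  : All (λ M → PairwiseDisjoint (map varsLabel M)) Q
      vars⊆           : varsΣΠ Q ⊆ X
      smallFactor     : sizeΣΠ Q ≤ factorSize

  record GoodTerm (k : ℕ) (X : Subset n) (R : ΠΣΠ-Formula n) : Set (c Level.⊔ ℓ₁) where
    field
      -- Each of the `k` cuts contributes a walk sum and an edge label; the last factor is the uncut
      -- remainder.
      fewFactors      : length R ≤ k * 2 + 1
      disjointFactors : PairwiseDisjoint (map varsΣΠ R)
      factors         : All (GoodFactor X) R

  open GoodFactor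
  open GoodTerm

  GoodFactor-⊆ : ∀ {X Y Q} → X ⊆ Y → GoodFactor X Q → GoodFactor Y Q
  GoodFactor-⊆ X⊆Y good = record
    { multilinearΣΠ  = multilinearΣΠ good
    ; fewVars        = fewVars good
    ; disjointLeaves = disjointLeaves good
    ; vars⊆          = X⊆Y ∘ vars⊆ good
    ; smallFactor    = smallFactor good
    }

  collect-good : ∀ p {X} → ∣ X ∣ ≤ r → GoodFactor X (collect p X)
  collect-good p {X} ∣X∣≤r = record
    { multilinearΣΠ  = collect-multilinear p X
    ; fewVars        = ℕ.≤-trans (p⊆q⇒∣p∣≤∣q∣ (varsΣΠ-collect p X)) ∣X∣≤r
    ; disjointLeaves = collect-disjoint p X
    ; vars⊆          = varsΣΠ-collect p X
    ; smallFactor    = ℕ.≤-trans (sizeΣΠ-collect p X)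
                         (s≤s (ℕ.*-mono-≤ (ℕ.^-monoʳ-≤ 2 ∣X∣≤r) (ℕ.+-monoʳ-≤ 2 ∣X∣≤r)))
    }

  ∣varsLabel∣≤r : ∀ (l : Label n) → ∣ varsLabel l ∣ ≤ r
  ∣varsLabel∣≤r (var i)   = subst (_≤ r) (sym (∣⁅x⁆∣≡1 i)) 1≤r
  ∣varsLabel∣≤r (const _) = subst (_≤ r) (sym (∣⊥∣≡0 n)) z≤n

  Expands : ∀ {g} → (ΠΣΠ-Formula n → Set g) → ℕ → Poly n → Set _
  Expands Good b p = ∃ λ Φ → All Good Φ × length Φ ≤ b × ⟦ Φ ⟧ ≃ p

  Expands-zero : ∀ {g} {Good : ΠΣΠ-Formula n → Set g} {b p} → p ≃ [] → Expands Good b p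
  Expands-zero p≃0 = [] , [] , z≤n , ≃-sym p≃0

  Expands-resp : ∀ {g} {Good : ΠΣΠ-Formula n → Set g} {b p q} → p ≃ q → Expands Good b p → Expands Good b q
  Expands-resp p≃q (Φ , good , count , value) = Φ , good , count , ≃-trans value p≃q

  Expands-∑ : ∀ {g a} {Good : ΠΣΠ-Formula n → Set g} {A : Set a} {b} xs {f : A → Poly n} →
              (∀ x → Expands Good b (f x)) → Expands Good (length xs * b) (∑ xs f)
  Expands-∑ []       each = Expands-zero ≃-refl
  Expands-∑ (x ∷ xs) each with each x | Expands-∑ xs each
  ... | Φ , good , count , value | Ψ , good′ , count′ , value′ =
    Φ ++ Ψ
    , All.++⁺ good good′
    , subst (_≤ _) (sym (length-++ Φ)) (ℕ.+-mono-≤ count count′)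
    , ≃-trans (≃-reflexive (trans (cong Σₚ (map-++ ⟦_⟧ΠΣΠ Φ Ψ)) (∑-++ (map ⟦_⟧ΠΣΠ Φ) _)))
              (+ₚ-cong value value′)

  -- The set W of the overview. The path is demanded separately because an unreachable node has an
  -- empty `Vars u w`; a node that is reachable but not near thus has more than r variables.
  near? : ∀ u w → Dec (Path u w × ∣ Vars u w ∣ ≤ r)
  near? u w = path? u w ×-dec (∣ Vars u w ∣ ℕ.≤? r)

  near : Fin S → Fin S → Bool
  near u w = does (near? u w)

  near-self : ∀ u → near u u ≡ true
  near-self u = dec-true (near? u u) ([] , subst (_≤ r) (sym (∣Vars-self∣ u)) z≤n)

  1≤[S*S]^ : ∀ k → 1 ≤ (S * S) ^ k
  1≤[S*S]^ k = positive S t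
    where
    positive : ∀ S → Fin S → 1 ≤ (S * S) ^ k
    positive (suc S) _ = ℕ.m^n>0 (suc S * suc S) k

  cutTerm : Fin S → Fin S → Fin S → Poly n
  cutTerm u w v = connection (near u) u w *ₚ (arc (not ∘ near u) w v *ₚ toSink v)

  cutTerm-zero : ∀ u w v → arc (not ∘ near u) w v ≡ [] → cutTerm u w v ≃ []
  cutTerm-zero u w v arc≡[] = ≃-trans
    (≃-reflexive (cong (λ a → connection (near u) u w *ₚ (a *ₚ toSink v)) arc≡[]))
    (*ₚ-zeroʳ (connection (near u) u w))

  toSink-cuts : ∀ {u} → ¬ ∣ Vars u t ∣ ≤ r →
                ∑ vertices (λ w → ∑ vertices (cutTerm u w)) ≃ toSink u
  toSink-cuts {u} big = ≃-sym (≃-trans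
    (first-exit (near u) (dec-false (near? u t) (big ∘ proj₂)) (near-self u))
    (∑-cong vertices λ w → *ₚ-distribˡ-∑ (connection (near u) u w) vertices
                             (λ v → arc (not ∘ near u) w v *ₚ toSink v)))

  -- The two new factors and the old ones live in X(u,w), X(w,v) and X(v,t) along u → w → v → t.
  -- Neighbouring sets are disjoint; for the outer two, X(v,t) is first enlarged to X(w,t).
  prefix : ∀ {k u w v l R} → Path u w → ∣ Vars u w ∣ ≤ r → edge w v ≡ just l →
           GoodTerm k (Vars v t) R →
           GoodTerm (suc k) (Vars u t)
             (collect (connection (near u) u w) (Vars u w) ∷ collect (labelₚ l) (varsLabel l) ∷ R)
  prefix {u = u} {w} {v} {l} {R} p small eq good = record
    { fewFactors      = s≤s (s≤s (fewFactors good))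
    ; disjointFactors =
        (separate (vars⊆ goodˡ) (vars⊆ goodᵉ) ∷ All.map⁺ (All.map (λ g → separate (vars⊆ goodˡ) (Vars-monoˡ w→v ∘ vars⊆ g)) (factors good)))
        ∷ All.map⁺ (All.map (λ g → separate (vars⊆ goodᵉ) (vars⊆ g)) (factors good))
        ∷ disjointFactors good
    ; factors         =
        GoodFactor-⊆ (Vars-monoʳ (reaches-t w)) goodˡ
        ∷ GoodFactor-⊆ (Vars-monoˡ p ∘ Vars-monoʳ (reaches-t v)) goodᵉ
        ∷ All.map (GoodFactor-⊆ (Vars-monoˡ (p ++ᵖ w→v))) (factors good)
    }
    where
    w→v : Path w v
    w→v = (l , eq) ∷ []

    goodˡ : GoodFactor (Vars u w) (collect (connection (near u) u w) (Vars u w))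
    goodˡ = collect-good (connection (near u) u w) small

    goodᵉ : GoodFactor (Vars w v) (collect (labelₚ l) (varsLabel l))
    goodᵉ = GoodFactor-⊆ (varsLabel⊆Vars eq) (collect-good (labelₚ l) (∣varsLabel∣≤r l))

    separate : ∀ {x y z A B} → A ⊆ Vars x y → B ⊆ Vars y z → Empty (A ∩ B)
    separate A⊆ B⊆ (i , i∈) =
      Vars-disjoint multilinear (A⊆ (proj₁ (x∈p∩q⁻ _ _ i∈))) (B⊆ (proj₂ (x∈p∩q⁻ _ _ i∈)))

  -- Here `k` is the number of cuts still allowed. A cut uses at least r+1 variables and so lowers
  -- the budget (k+1)(r+1) by one block; at k = 0 at most r variables remain and no cut is made.
  -- Each cut chooses a pair of nodes, hence S·S to the power `k`.
  expand : ∀ k u → ∣ Vars u t ∣ < suc k * suc r →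
           Expands (GoodTerm k (Vars u t)) ((S * S) ^ k) (toSink u)
  expand k u bound with ∣ Vars u t ∣ ℕ.≤? r
  ... | yes small =
    [ [ collect (toSink u) (Vars u t) ] ]
    , record { fewFactors = ℕ.m≤n+m 1 (k * 2)
             ; disjointFactors = [] ∷ []
             ; factors = collect-good (toSink u) small ∷ []
             } ∷ []
    , 1≤[S*S]^ k
    , ≃-trans (Pₚ.+-identityʳ _) (≃-trans (Pₚ.*-identityʳ _)
        (⟦collect⟧-correct (connection-supported multilinear everywhere u t)))
  expand zero u bound | no big =
    contradiction (ℕ.m<1+n⇒m≤n (subst (∣ Vars u t ∣ <_) (ℕ.+-identityʳ (suc r)) bound)) big
  expand (suc k) u bound | no big = Expands-resp (toSink-cuts big)
    (subst (λ b → Expands (GoodTerm (suc k) (Vars u t)) b (∑ vertices (λ w → ∑ vertices (cutTerm u w)))) count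
      (Expands-∑ vertices λ w → Expands-∑ vertices λ v →
        block w v (near? u w) (near? u v) (edge w v) refl))
    where
    count : length vertices * (length vertices * (S * S) ^ k) ≡ (S * S) ^ suc k
    count = trans (cong (λ m → m * (m * (S * S) ^ k)) (length-tabulate {n = S} id)) (sym (ℕ.*-assoc S S ((S * S) ^ k)))

    -- X(u,v) and X(v,t) are disjoint inside X(u,t), and the former already takes r+1 variables.
    rest-bound : ∀ {v} → Path u v → r < ∣ Vars u v ∣ → ∣ Vars v t ∣ < suc k * suc r
    rest-bound {v} p far = ℕ.+-cancelˡ-< (suc r) _ _ (ℕ.≤-<-trans
      (ℕ.≤-trans (ℕ.+-monoˡ-≤ ∣ Vars v t ∣ far) (∣Vars∣-superadditive multilinear p (reaches-t v)))
      bound)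

    -- A pair contributes only if `w` is near, `v` is not, and an edge joins them. All other pairs
    -- give the zero polynomial, expanded by the empty formula.
    block : ∀ w v → Dec (Path u w × ∣ Vars u w ∣ ≤ r) → Dec (Path u v × ∣ Vars u v ∣ ≤ r) →
            (e : Maybe (Label n)) → edge w v ≡ e →
            Expands (GoodTerm (suc k) (Vars u t)) ((S * S) ^ k) (cutTerm u w v)
    block w v (no ¬near-w) _ _ _ = Expands-zero (*ₚ-cong
      (walks-outside (near u) (distance u w) (near-self u) (dec-false (near? u w) ¬near-w)) ≃-refl)
    block w v (yes _) (yes near-v) _ _ = Expands-zero (cutTerm-zero u w v
      (arc-false (not ∘ near u) w v (cong not (dec-true (near? u v) near-v))))
    block w v (yes _) (no _) nothing eq = Expands-zero (cutTerm-zero u w v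
      (arc-nothing (not ∘ near u) w v eq))
    block w v (yes (p , small)) (no ¬near-v) (just l) eq
      with expand k v (rest-bound (p ++ᵖ (l , eq) ∷ []) (ℕ.≰⇒> λ ≤r → ¬near-v (p ++ᵖ (l , eq) ∷ [] , ≤r)))
    ... | Φ , good , few , value =
      map (λ R → Q ∷ E ∷ R) Φ
      , All.map⁺ (All.map (prefix p small eq) good)
      , subst (_≤ (S * S) ^ k) (sym (length-map (λ R → Q ∷ E ∷ R) Φ)) few
      , (begin
        ∑ (map (λ R → Q ∷ E ∷ R) Φ) ⟦_⟧ΠΣΠ
          ≡⟨ ∑-map ⟦_⟧ΠΣΠ (λ R → Q ∷ E ∷ R) Φ ⟩
        ∑ Φ (λ R → ⟦ Q ⟧ΣΠ *ₚ (⟦ E ⟧ΣΠ *ₚ ⟦ R ⟧ΠΣΠ))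
          ≈⟨ *ₚ-distribˡ-∑ ⟦ Q ⟧ΣΠ Φ (λ R → ⟦ E ⟧ΣΠ *ₚ ⟦ R ⟧ΠΣΠ) ⟨
        ⟦ Q ⟧ΣΠ *ₚ ∑ Φ (λ R → ⟦ E ⟧ΣΠ *ₚ ⟦ R ⟧ΠΣΠ)
          ≈⟨ *ₚ-congˡ ⟦ Q ⟧ΣΠ (*ₚ-distribˡ-∑ ⟦ E ⟧ΣΠ Φ ⟦_⟧ΠΣΠ) ⟨
        ⟦ Q ⟧ΣΠ *ₚ (⟦ E ⟧ΣΠ *ₚ ⟦ Φ ⟧)
          ≈⟨ *ₚ-cong (⟦collect⟧-correct (connection-supported multilinear (near u) u w))
                     (*ₚ-cong (⟦collect⟧-correct (labelₚ-supported l)) value) ⟩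
        connection (near u) u w *ₚ (labelₚ l *ₚ toSink v)
          ≡⟨ cong (λ a → connection (near u) u w *ₚ (a *ₚ toSink v))
                  (arc-just (not ∘ near u) w v (cong not (dec-false (near? u v) ¬near-v)) eq) ⟨
        cutTerm u w v ∎)
      where
      open SetoidReasoning Pₚ.setoid
      Q E : ΣΠ-Formula n
      Q = collect (connection (near u) u w) (Vars u w)
      E = collect (labelₚ l) (varsLabel l)

  sizeΠΣΠ-good : ∀ {k X R} → GoodTerm k X R → sizeΠΣΠ R ≤ suc ((k * 2 + 1) * factorSize)
  sizeΠΣΠ-good good = s≤s (ℕ.≤-trans (sum-≤ sizeΣΠ (All.map smallFactor (factors good)))
                                     (ℕ.*-monoˡ-≤ factorSize (fewFactors good)))

-- Numerical estimates for the size.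

suc-≤-2^ : ∀ k → suc k ≤ 2 ^ k
suc-≤-2^ zero    = s≤s z≤n
suc-≤-2^ (suc k) = ℕ.+-mono-≤ (ℕ.m^n>0 2 k) (ℕ.≤-trans (suc-≤-2^ k) (ℕ.m≤m+n (2 ^ k) 0))

suc-mono-2^ : ∀ {m} k → m ≤ 2 ^ k → suc m ≤ 2 ^ suc k
suc-mono-2^ k m≤ = ℕ.+-mono-≤ (ℕ.m^n>0 2 k) (ℕ.≤-trans m≤ (ℕ.m≤m+n (2 ^ k) 0))

*-mono-2^ : ∀ {m m′} k k′ → m ≤ 2 ^ k → m′ ≤ 2 ^ k′ → m * m′ ≤ 2 ^ (k + k′)
*-mono-2^ {m} {m′} k k′ m≤ m′≤ = subst (m * m′ ≤_) (sym (ℕ.^-distribˡ-+-* 2 k k′)) (ℕ.*-mono-≤ m≤ m′≤)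

-- Rounding the logarithm down gives only m < 2^(⌊log₂ m⌋ + 1). Of the two copies of `log⁺ m`, which
-- is at least 1, one absorbs the added 1.
≤2^log⁺ : ∀ m → m ≤ 2 ^ (2 * log⁺ m)
≤2^log⁺ m = ℕ.≤-trans (ℕ.<⇒≤ m<) (ℕ.^-monoʳ-≤ 2
  (ℕ.+-mono-≤ (ℕ.m≤m⊔n 1 ⌊log₂ m ⌋) (ℕ.≤-trans (ℕ.m≤n⊔m 1 ⌊log₂ m ⌋) (ℕ.m≤m+n (log⁺ m) 0))))
  where
  m< : m < 2 ^ suc ⌊log₂ m ⌋
  m< = ℕ.≰⇒> λ ≤m → ℕ.<-irrefl refl
    (subst (_≤ ⌊log₂ m ⌋) (⌊log₂[2^n]⌋≡n (suc ⌊log₂ m ⌋)) (⌊log₂⌋-mono-≤ ≤m))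

-- The left side counts (S·S)^r products of at most 2r+1 factors of size at most `factorSize`; the
-- two outer `suc` are the top sum gate and the gate of each product.
size-bound : ∀ S r N → 1 ≤ r → 1 ≤ N →
  suc ((S * S) ^ r * suc ((r * 2 + 1) * suc (2 ^ r * (2 + r)))) ≤ 2 ^ (12 * (r * N * log⁺ S))
size-bound S r N 1≤r 1≤N = ℕ.≤-trans
  (suc-mono-2^ (4 * L * r + suc (suc r + suc (r + suc r)))
    (*-mono-2^ (4 * L * r) (suc (suc r + suc (r + suc r))) terms
      (suc-mono-2^ (suc r + suc (r + suc r)) (*-mono-2^ (suc r) (suc (r + suc r)) factors
        (suc-mono-2^ (r + suc r) (*-mono-2^ r (suc r) ℕ.≤-refl (suc-≤-2^ (suc r))))))))
  (ℕ.^-monoʳ-≤ 2 exponent)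
  where
  L = log⁺ S

  1≤L : 1 ≤ L
  1≤L = ℕ.m≤m⊔n 1 ⌊log₂ S ⌋

  terms : (S * S) ^ r ≤ 2 ^ (4 * L * r)
  terms = subst ((S * S) ^ r ≤_) (ℕ.^-*-assoc 2 (4 * L) r) (ℕ.^-monoˡ-≤ r
    (subst (λ k → S * S ≤ 2 ^ k) (double L) (*-mono-2^ (2 * L) (2 * L) (≤2^log⁺ S) (≤2^log⁺ S))))
    where
    double : ∀ x → 2 * x + 2 * x ≡ 4 * x
    double = solve-∀

  factors : r * 2 + 1 ≤ 2 ^ suc r
  factors = subst (r * 2 + 1 ≤_) (ℕ.*-comm (2 ^ r) 2)
    (ℕ.≤-trans (subst (_≤ suc r * 2) (ℕ.+-comm 1 (r * 2)) (ℕ.n≤1+n _)) (ℕ.*-monoˡ-≤ 2 (suc-≤-2^ r)))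

  rL≤rNL : r * L ≤ r * N * L
  rL≤rNL = ℕ.*-monoˡ-≤ L (subst (_≤ r * N) (ℕ.*-identityʳ r) (ℕ.*-monoʳ-≤ r 1≤N))

  r≤rL : r ≤ r * L
  r≤rL = subst (_≤ r * L) (ℕ.*-identityʳ r) (ℕ.*-monoʳ-≤ r 1≤L)

  -- The (S·S)^r products account for 4rL; 2r+1, 2^r and 2+r for one r each; the 5 comes from three
  -- gates and from bounding both 2r+1 and 2+r by 2^(r+1). Since 1 ≤ r ≤ rL, the total is at most
  -- (4+3+5)rL.
  exponent : suc (4 * L * r + suc (suc r + suc (r + suc r))) ≤ 12 * (r * N * L)
  exponent = begin
    suc (4 * L * r + suc (suc r + suc (r + suc r)))  ≡⟨ expandˡ L r ⟩
    4 * (r * L) + 3 * r + 5 * 1                      ≤⟨ ℕ.+-mono-≤ (ℕ.+-monoʳ-≤ (4 * (r * L)) (ℕ.*-monoʳ-≤ 3 r≤rL))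
                                                          (ℕ.*-monoʳ-≤ 5 (ℕ.≤-trans 1≤r r≤rL)) ⟩
    4 * (r * L) + 3 * (r * L) + 5 * (r * L)          ≡⟨ expandʳ (r * L) ⟩
    12 * (r * L)                                     ≤⟨ ℕ.*-monoʳ-≤ 12 rL≤rNL ⟩
    12 * (r * N * L)                                 ∎
    where
    open ℕ.≤-Reasoning
    expandˡ : ∀ L r → suc (4 * L * r + suc (suc r + suc (r + suc r))) ≡ 4 * (r * L) + 3 * r + 5 * 1
    expandˡ = solve-∀
    expandʳ : ∀ x → 4 * x + 3 * x + 5 * x ≡ 12 * x
    expandʳ = solve-∀

corollary1 : (c ℓ₁ ℓ₂ : Level) →
    ∃ λ (k₁ : ℕ) → ∃ λ (k₂ : ℕ) → ∃ λ (k₃ : ℕ) →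
    (F : HeytingField c ℓ₁ ℓ₂) → let open OverField F in
    (n S : ℕ) (P : ABP n S) (f : Poly n) →
    ABP.SyntacticMultilinear P →
    ABP.polynomial P ≈ₚ f →
    ∃ λ (Φ : ΣΠΣΠ-Formula n) →
    IsΣΠ[√n]⟨ΣΠ⟩[√n] k₁ k₂ Φ
    × FormulaSyntacticMultilinear Φ
    × size Φ ≤ 2 ^ (k₃ * (√⁺ n * log⁺ n * log⁺ S))
    × ⟦ Φ ⟧ ≈ₚ f
-- A product has at most 2r+1 ≤ 3r factors because r ≥ 1, a factor has at most r variables, and 12
-- is the constant of `size-bound`.
corollary1 c ℓ₁ ℓ₂ = 3 , 1 , 12 , λ F n S P f multilinear computes →
  let open OverField F
      open ABP P using (s; t)
      open Polynomials F n using (≃-trans; ≃-sym; coefficientwise; coeff-cong)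
      open Programs F P using (Vars; polynomial≃toSink)
      r = √⁺ n
      1≤r = ℕ.m≤m⊔n 1 ⌊√ n ⌋
      open Expansion F P multilinear r 1≤r
      open GoodTerm
      open GoodFactor
      ⌊√n⌋<1+r = s≤s (ℕ.m≤n⊔m 1 ⌊√ n ⌋)
      Φ , good , count , value = expand r s
        -- The initial budget is n < (⌊√n⌋+1)^2 ≤ (r+1)^2, which allows `r` cuts.
        (ℕ.≤-<-trans (∣p∣≤n (Vars s t)) (ℕ.<-≤-trans (proj₂ (⌊√⌋-spec n)) (ℕ.*-mono-≤ ⌊√n⌋<1+r ⌊√n⌋<1+r)))
  in Φ
   , All.map (λ {R} g → ℕ.≤-trans (fewFactors g)
                          (subst (r * 2 + 1 ≤_) (trans (sym (ℕ.*-suc r 2)) (ℕ.*-comm r 3))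
                            (ℕ.≤-trans (ℕ.+-monoʳ-≤ (r * 2) 1≤r) (ℕ.≤-reflexive (ℕ.+-comm (r * 2) r))))
                      , All.map (λ h → multilinearΣΠ h , ℕ.≤-trans (fewVars h) (ℕ.≤-reflexive (sym (ℕ.*-identityˡ r)))) (factors g))
             good
   , All.map (λ g → disjointFactors g , All.map disjointLeaves (factors g)) good
   , ℕ.≤-trans (s≤s (ℕ.≤-trans (sum-≤ sizeΠΣΠ (All.map sizeΠΣΠ-good good)) (ℕ.*-monoˡ-≤ _ count)))
               (size-bound S r (log⁺ n) 1≤r (ℕ.m≤m⊔n 1 ⌊log₂ n ⌋))
   , coeff-cong (≃-trans value (≃-trans (≃-sym polynomial≃toSink) (coefficientwise {q = f} computes)))
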